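{- Let $2<s<3$. For all sufficiently large $n$ there exists a function $f\colon\mathbb{F}_2^n\to\mathbb{F}_2$ of degree $3$ with algebraic thickness $\mathcal{T}(f)\leq n^{s}$ such that every $0$-restriction of $f$ on at least $3\sqrt{\ln n}\;n^{\frac{3-s}{2}}$ variables has degree $3$.
   Context: Every $f\colon\mathbb{F}_2^n\to\mathbb{F}_2$ is uniquely a multilinear polynomial over $\mathbb{F}_2$ (its algebraic normal form): $f(x)=\sum_{S\subseteq[n]}c_S\prod_{j\in S}x_j$ with $c_S\in\{0,1\}$ and $[n]=\{1,\dots,n\}$. The degree of $f$ is the largest $|S|$ with $c_S=1$, and the sparsity $\|f\|$ is the number of $S$ with $c_S=1$. The algebraic thickness is $\mathcal{T}(f)=\min_{A\in\mathcal{A}_n}\|f\circ A\|$, where $\mathcal{A}_n$ is the set of affine bijections $\mathbb{F}_2^n\to\mathbb{F}_2^n$. A $0$-restriction of $f$ is a function $f'$ on $n-k$ variables obtained from $f$ by setting some $k<n$ of the input variables to $0$; $n-k$ is its dimension. $\ln$ is the natural logarithm. -}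

module Defs where

open import Algebra.Definitions.RawSemiring using () renaming (_^_ to power)
open import Data.Bool using (T?)
open import Data.Bool.Base using (Bool; true; false; T; _∧_; _xor_)
import Data.Bool.Properties as Bool
open import Data.Fin.Subset using (Subset; inside; outside; ∣_∣)
open import Data.Fin.Subset.Properties using (anySubset?)
open import Data.Integer.Base as ℤ using (+_)
open import Data.List.Base
  using (List; []; _∷_; _++_; map; filter; filterᵇ; foldr; length; cartesianProduct; cartesianProductWith)
open import Data.List.Extrema.Nat using (min; min≤v⁺; argmin-sel)
open import Data.List.Membership.Propositional using (_∈_)
open import Data.List.Membership.Propositional.Properties
  using (∈-cartesianProduct⁺; ∈-cartesianProductWith⁺; ∈-filter⁺; ∈-filter⁻; ∈-map⁺; ∈-map⁻)
open import Data.List.Properties using (++-identityʳ; filter-≐; map-++; map-∘)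
open import Data.List.Relation.Unary.Any as Any using (here; there)
open import Data.Nat.Base as ℕ using (ℕ; zero; suc)
import Data.Nat.Properties as ℕ
open import Data.Product.Base using (∃-syntax; _×_; _,_; proj₁; proj₂)
open import Data.Rational.Base as ℚ using (ℚ; 0ℚ; 1ℚ)
import Data.Rational.Properties as ℚ
open import Data.Sum.Base using (_⊎_; inj₁; inj₂)
open import Data.Vec.Base as Vec using (Vec; []; _∷_)
import Data.Vec.Properties as Vec
open import Function.Base using (_∘_; id)
open import Function.Definitions using (Bijective; Injective; Surjective)
open import Relation.Binary.PropositionalEquality
open import Relation.Nullary using (¬_; Dec; yes; no; ¬?; _×-dec_; _→-dec_)
open import Relation.Nullary.Decidable using (map′; decidable-stable)
open import Relation.Unary using (Decidable)

------------------------------------------------------------------------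
-- Boolean functions and their algebraic normal form

-- Bool is the field with two elements: _xor_ is addition, _∧_ is
-- multiplication.
𝔽₂ : Set
𝔽₂ = Bool

BoolFun : ℕ → Set
BoolFun n = Vec 𝔽₂ n → 𝔽₂

vectors : ∀ {A : Set} → List A → ∀ n → List (Vec A n)
vectors as zero    = [] ∷ []
vectors as (suc n) = cartesianProductWith _∷_ as (vectors as n)

subsets : ∀ n → List (Subset n)
subsets = vectors (outside ∷ inside ∷ [])

⨁ : List 𝔽₂ → 𝔽₂
⨁ = foldr _xor_ false

monomial : ∀ {n} → Subset n → BoolFun n
monomial []            []      = true
monomial (inside  ∷ S) (b ∷ x) = b ∧ monomial S x
monomial (outside ∷ S) (_ ∷ x) = monomial S x

-- The function of the multilinear polynomial with coefficients c.
⟦_⟧ : ∀ {n} → (Subset n → 𝔽₂) → BoolFun n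
⟦_⟧ {n} c x = ⨁ (map (λ S → c S ∧ monomial S x) (subsets n))

-- The coefficients of the algebraic normal form; see ⟦coeff⟧ and
-- coeff-unique.
coeff : ∀ {n} → BoolFun n → Subset n → 𝔽₂
coeff f []            = f []
coeff f (outside ∷ S) = coeff (λ x → f (false ∷ x)) S
coeff f (inside  ∷ S) = coeff (λ x → f (false ∷ x) xor f (true ∷ x)) S

private
  ⨁-++ : ∀ xs ys → ⨁ (xs ++ ys) ≡ ⨁ xs xor ⨁ ys
  ⨁-++ []       ys = refl
  ⨁-++ (x ∷ xs) ys = trans (cong (x xor_) (⨁-++ xs ys))
                           (sym (Bool.xor-assoc x (⨁ xs) (⨁ ys)))

  ⨁-false : ∀ {A : Set} (c : A → 𝔽₂) xs → ⨁ (map (λ a → c a ∧ false) xs) ≡ false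
  ⨁-false c []       = refl
  ⨁-false c (a ∷ xs) = cong₂ _xor_ (Bool.∧-zeroʳ (c a)) (⨁-false c xs)

  xor-cancelˡ : ∀ a b → a xor (a xor b) ≡ b
  xor-cancelˡ false b = refl
  xor-cancelˡ true  b = Bool.not-involutive b

  ⟦⟧-split : ∀ {n} (c : Subset (suc n) → 𝔽₂) b x →
    ⟦ c ⟧ (b ∷ x) ≡
      ⟦ c ∘ (outside ∷_) ⟧ x xor
      ⨁ (map (λ S → c (inside ∷ S) ∧ (b ∧ monomial S x)) (subsets n))
  ⟦⟧-split {n} c b x = begin
    ⨁ (map t (map (outside ∷_) Ss ++ map (inside ∷_) Ss ++ []))
      ≡⟨ cong (λ ys → ⨁ (map t (map (outside ∷_) Ss ++ ys))) (++-identityʳ _) ⟩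
    ⨁ (map t (map (outside ∷_) Ss ++ map (inside ∷_) Ss))
      ≡⟨ cong ⨁ (map-++ t (map (outside ∷_) Ss) _) ⟩
    ⨁ (map t (map (outside ∷_) Ss) ++ map t (map (inside ∷_) Ss))
      ≡⟨ ⨁-++ (map t (map (outside ∷_) Ss)) _ ⟩
    ⨁ (map t (map (outside ∷_) Ss)) xor ⨁ (map t (map (inside ∷_) Ss))
      ≡⟨ cong₂ (λ ys zs → ⨁ ys xor ⨁ zs) (sym (map-∘ Ss)) (sym (map-∘ Ss)) ⟩
    ⨁ (map (t ∘ (outside ∷_)) Ss) xor ⨁ (map (t ∘ (inside ∷_)) Ss) ∎
    where
    open ≡-Reasoning
    Ss = subsets n
    t  = λ S → c S ∧ monomial S (b ∷ x)

  ⟦⟧-false : ∀ {n} (c : Subset (suc n) → 𝔽₂) x →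
    ⟦ c ⟧ (false ∷ x) ≡ ⟦ c ∘ (outside ∷_) ⟧ x
  ⟦⟧-false {n} c x = trans (⟦⟧-split c false x)
    (trans (cong (⟦ c ∘ (outside ∷_) ⟧ x xor_) (⨁-false (c ∘ (inside ∷_)) (subsets n)))
           (Bool.xor-identityʳ _))

  ⟦⟧-true : ∀ {n} (c : Subset (suc n) → 𝔽₂) x →
    ⟦ c ⟧ (true ∷ x) ≡ ⟦ c ∘ (outside ∷_) ⟧ x xor ⟦ c ∘ (inside ∷_) ⟧ x
  ⟦⟧-true c x = ⟦⟧-split c true x

⟦coeff⟧ : ∀ {n} (f : BoolFun n) → ⟦ coeff f ⟧ ≗ f
⟦coeff⟧ f [] = trans (Bool.xor-identityʳ _) (Bool.∧-identityʳ (f []))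
⟦coeff⟧ f (false ∷ x) = trans (⟦⟧-false (coeff f) x) (⟦coeff⟧ (f ∘ (false ∷_)) x)
⟦coeff⟧ f (true  ∷ x) = trans (⟦⟧-true (coeff f) x)
  (trans (cong₂ _xor_ (⟦coeff⟧ (f ∘ (false ∷_)) x) (⟦coeff⟧ _ x))
         (xor-cancelˡ (f (false ∷ x)) (f (true ∷ x))))

coeff-unique : ∀ {n} (f : BoolFun n) c → ⟦ c ⟧ ≗ f → c ≗ coeff f
coeff-unique f c eq [] = trans
  (sym (trans (Bool.xor-identityʳ _) (Bool.∧-identityʳ (c [])))) (eq [])
coeff-unique f c eq (outside ∷ S) = coeff-unique _ (c ∘ (outside ∷_))
  (λ x → trans (sym (⟦⟧-false c x)) (eq (false ∷ x))) S
coeff-unique f c eq (inside ∷ S) = coeff-unique _ (c ∘ (inside ∷_))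
  (λ x → trans (sym (xor-cancelˡ (⟦ c ∘ (outside ∷_) ⟧ x) _))
    (cong₂ _xor_ (trans (sym (⟦⟧-false c x)) (eq (false ∷ x)))
                 (trans (sym (⟦⟧-true c x)) (eq (true ∷ x))))) S

coeff-cong : ∀ {n} {f g : BoolFun n} → f ≗ g → coeff f ≗ coeff g
coeff-cong {f = f} {g} f≗g =
  coeff-unique g (coeff f) (λ x → trans (⟦coeff⟧ f x) (f≗g x))

‖_‖ : ∀ {n} → BoolFun n → ℕ
‖_‖ {n} f = length (filterᵇ (coeff f) (subsets n))

-- Holds for no d when f is zero.
HasDegree : ∀ {n} → BoolFun n → ℕ → Set
HasDegree {n} f d =
  (∃[ S ] coeff f S ≡ true × ∣ S ∣ ≡ d) ×
  (∀ (S : Subset n) → coeff f S ≡ true → ∣ S ∣ ℕ.≤ d)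

------------------------------------------------------------------------
-- Algebraic thickness

-- (M , b) stands for x ↦ M x + b; M is given by its rows.
Affine : ℕ → Set
Affine n = Vec (Vec 𝔽₂ n) n × Vec 𝔽₂ n

_·_ : ∀ {n} → Vec 𝔽₂ n → Vec 𝔽₂ n → 𝔽₂
v · x = Vec.foldr′ _xor_ false (Vec.zipWith _∧_ v x)

apply : ∀ {n} → Affine n → Vec 𝔽₂ n → Vec 𝔽₂ n
apply (M , b) x = Vec.zipWith _xor_ (Vec.map (_· x) M) b

IsBijective : ∀ {n} → Affine n → Set
IsBijective A = Bijective _≡_ _≡_ (apply A)

private
  _≟_ : ∀ {n} (x y : Vec 𝔽₂ n) → Dec (x ≡ y)
  _≟_ = Vec.≡-dec Bool._≟_

  all? : ∀ {n} {P : Vec 𝔽₂ n → Set} → Decidable P → Dec (∀ x → P x)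
  all? P? = map′ (λ ¬∃ x → decidable-stable (P? x) (λ ¬p → ¬∃ (x , ¬p)))
                 (λ { ∀p (x , ¬p) → ¬p (∀p x) })
                 (¬? (anySubset? (λ x → ¬? (P? x))))

bijective? : ∀ {n} → Decidable (IsBijective {n})
bijective? A = injective? ×-dec surjective?
  where
  f = apply A

  injective? : Dec (Injective _≡_ _≡_ f)
  injective? = map′ (λ inj {x} {y} → inj x y) (λ inj x y → inj {x} {y})
    (all? λ x → all? λ y → (f x ≟ f y) →-dec (x ≟ y))

  surjective? : Dec (Surjective _≡_ _≡_ f)
  surjective? = map′ (λ sur y → proj₁ (sur y) , λ { refl → proj₂ (sur y) })
                     (λ sur y → proj₁ (sur y) , proj₂ (sur y) refl)
    (all? λ y → anySubset? λ x → f x ≟ y)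

affines : ∀ n → List (Affine n)
affines n = cartesianProduct (vectors (subsets n) n) (subsets n)

-- The default value ‖ f ‖ is the one at the identity, so this is the
-- minimum over the affine bijections; see thickness-attained and
-- thickness-minimal.
thickness : ∀ {n} → BoolFun n → ℕ
thickness {n} f =
  min ‖ f ‖ (map (λ A → ‖ f ∘ apply A ‖) (filter bijective? (affines n)))

private
  ∈-vectors : ∀ {A : Set} {as : List A} → (∀ a → a ∈ as) →
    ∀ {n} (v : Vec A n) → v ∈ vectors as n
  ∈-vectors h []      = here refl
  ∈-vectors h (a ∷ v) = ∈-cartesianProductWith⁺ _∷_ (h a) (∈-vectors h v)

  ∈-subsets : ∀ {n} (S : Subset n) → S ∈ subsets n
  ∈-subsets = ∈-vectors λ { false → here refl ; true → there (here refl) }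

  ∈-affines : ∀ {n} (A : Affine n) → A ∈ affines n
  ∈-affines (M , b) = ∈-cartesianProduct⁺ (∈-vectors ∈-subsets M) (∈-subsets b)

  zeros : ∀ n → Vec 𝔽₂ n
  zeros n = Vec.replicate n false

  unit : ∀ n → Vec (Vec 𝔽₂ n) n
  unit zero    = []
  unit (suc n) = (true ∷ zeros n) ∷ Vec.map (false ∷_) (unit n)

  zeros-· : ∀ {n} (x : Vec 𝔽₂ n) → zeros n · x ≡ false
  zeros-· []      = refl
  zeros-· (b ∷ x) = zeros-· x

  apply-unit : ∀ {n} (x : Vec 𝔽₂ n) → apply (unit n , zeros n) x ≡ x
  apply-unit [] = refl
  apply-unit {suc n} (b ∷ x) = cong₂ _∷_
    (trans (Bool.xor-identityʳ _)
      (trans (cong (b xor_) (zeros-· x)) (Bool.xor-identityʳ b)))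
    (trans (cong (λ v → Vec.zipWith _xor_ v (zeros n))
                 (sym (Vec.map-∘ (_· (b ∷ x)) (false ∷_) (unit n))))
           (apply-unit x))

  unit-bijective : ∀ n → IsBijective (unit n , zeros n)
  unit-bijective n =
    (λ {x} {y} eq → trans (sym (apply-unit x)) (trans eq (apply-unit y))) ,
    (λ y → y , λ { refl → apply-unit y })

  ‖‖-cong : ∀ {n} {f g : BoolFun n} → f ≗ g → ‖ f ‖ ≡ ‖ g ‖
  ‖‖-cong {n} {f} {g} f≗g = cong length (filter-≐ (T? ∘ coeff f) (T? ∘ coeff g)
    ( (λ {S} → subst T (coeff-cong f≗g S))
    , (λ {S} → subst T (sym (coeff-cong f≗g S)))) (subsets n))

thickness-minimal : ∀ {n} (f : BoolFun n) (A : Affine n) → IsBijective A →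
  thickness f ℕ.≤ ‖ f ∘ apply A ‖
thickness-minimal f A bij = min≤v⁺ ‖ f ‖ _ (inj₂
  (Any.map (λ eq → ℕ.≤-reflexive (sym eq))
    (∈-map⁺ (λ B → ‖ f ∘ apply B ‖) (∈-filter⁺ bijective? (∈-affines A) bij))))

thickness-attained : ∀ {n} (f : BoolFun n) →
  ∃[ A ] IsBijective {n} A × thickness f ≡ ‖ f ∘ apply A ‖
thickness-attained {n} f
  with argmin-sel id ‖ f ‖ (map (λ A → ‖ f ∘ apply A ‖) (filter bijective? (affines n)))
... | inj₁ eq = _ , unit-bijective n ,
  trans eq (‖‖-cong (λ x → cong f (sym (apply-unit x))))
... | inj₂ t∈ with ∈-map⁻ (λ A → ‖ f ∘ apply A ‖) t∈
...   | A , A∈ , eq = A , proj₂ (∈-filter⁻ bijective? {xs = affines n} A∈) , eq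

------------------------------------------------------------------------
-- 0-restrictions

-- Places y on the coordinates in K and 0 on the others.
extend : ∀ {n} (K : Subset n) → Vec 𝔽₂ ∣ K ∣ → Vec 𝔽₂ n
extend []            []      = []
extend (inside  ∷ K) (b ∷ y) = b ∷ extend K y
extend (outside ∷ K) y       = false ∷ extend K y

-- The variables outside K are set to 0; the dimension is ∣ K ∣.
restrict : ∀ {n} → BoolFun n → (K : Subset n) → BoolFun ∣ K ∣
restrict f K y = f (extend K y)

------------------------------------------------------------------------
-- Real numbers as two-sided Dedekind cuts

-- L q means q < x, and U q means x < q.
record Cut : Set₁ where
  constructor cut
  field
    L U : ℚ → Set

open Cut

-- Locatedness rules out a gap between L and U; classically it says that at
-- most one rational lies in neither.
record IsDedekind (x : Cut) : Set where
  field
    L-inhabited : ∃[ q ] L x q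
    U-inhabited : ∃[ q ] U x q
    L-lower     : ∀ {q r} → q ℚ.< r → L x r → L x q
    U-upper     : ∀ {q r} → q ℚ.< r → U x q → U x r
    L-open      : ∀ {q} → L x q → ∃[ r ] q ℚ.< r × L x r
    U-open      : ∀ {r} → U x r → ∃[ q ] q ℚ.< r × U x q
    disjoint    : ∀ {q} → L x q → ¬ U x q
    located     : ∀ {q r} → q ℚ.< r → L x q ⊎ U x r

infix 4 _<_ _≤_

_<_ : Cut → Cut → Set
x < y = ∃[ q ] U x q × L y q

_≤_ : Cut → Cut → Set
x ≤ y = ∀ {q} → L x q → L y q

fromℚ : ℚ → Cut
fromℚ p = cut (λ q → q ℚ.< p) (λ q → p ℚ.< q)

fromℕ : ℕ → Cut
fromℕ n = fromℚ (+ n ℚ./ 1)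

infixl 6 _-_
infixl 7 _*_

_-_ : Cut → Cut → Cut
x - y = cut
  (λ q → ∃[ a ] ∃[ b ] L x a × U y b × q ℚ.< a ℚ.- b)
  (λ q → ∃[ a ] ∃[ b ] U x a × L y b × a ℚ.- b ℚ.< q)

-- If a < x < b and c < y < d, then x * y lies between the least and the
-- greatest of the four products.
_*_ : Cut → Cut → Cut
x * y = cut
  (λ q → ∃[ a ] ∃[ b ] ∃[ c ] ∃[ d ] L x a × U x b × L y c × U y d ×
     q ℚ.< a ℚ.* c × q ℚ.< a ℚ.* d × q ℚ.< b ℚ.* c × q ℚ.< b ℚ.* d)
  (λ q → ∃[ a ] ∃[ b ] ∃[ c ] ∃[ d ] L x a × U x b × L y c × U y d ×
     a ℚ.* c ℚ.< q × a ℚ.* d ℚ.< q × b ℚ.* c ℚ.< q × b ℚ.* d ℚ.< q)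

-- For x ≥ 0.
√ : Cut → Cut
√ x = cut
  (λ q → q ℚ.< 0ℚ ⊎ L x (q ℚ.* q))
  (λ q → 0ℚ ℚ.< q × U x (q ℚ.* q))

infixr 8 _^ℚ_ _^_

_^ℚ_ : ℚ → ℕ → ℚ
_^ℚ_ = power ℚ.+-*-rawSemiring

-- For a positive integer n, the power n ^ y is the supremum of n ^ r over
-- rational r < y and the infimum over r > y.  With r = (i - j) / (1 + k)
-- and q > 0, the comparison of q with n ^ r is that of
-- q ^ (1 + k) * n ^ j with n ^ i.
_^_ : ℕ → Cut → Cut
n ^ y = cut
  (λ q → q ℚ.≤ 0ℚ ⊎
     ∃[ i ] ∃[ j ] ∃[ k ] L y ((+ i ℤ.- + j) ℚ./ suc k) ×
       q ^ℚ suc k ℚ.* (+ (n ℕ.^ j) ℚ./ 1) ℚ.< + (n ℕ.^ i) ℚ./ 1)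
  (λ q → 0ℚ ℚ.< q ×
     ∃[ i ] ∃[ j ] ∃[ k ] U y ((+ i ℤ.- + j) ℚ./ suc k) ×
       + (n ℕ.^ i) ℚ./ 1 ℚ.< q ^ℚ suc k ℚ.* (+ (n ℕ.^ j) ℚ./ 1))

-- While the bases are positive, (1 + a / k) ^ k increases to the
-- exponential of a and (1 - a / k) ^ (- k) decreases to it.
exp : ℚ → Cut
exp a = cut
  (λ q → ∃[ k ] let t = 1ℚ ℚ.+ a ℚ.* (+ 1 ℚ./ suc k) in
     0ℚ ℚ.< t × q ℚ.< t ^ℚ suc k)
  (λ q → ∃[ k ] let t = 1ℚ ℚ.- a ℚ.* (+ 1 ℚ./ suc k) in
     0ℚ ℚ.< t × 1ℚ ℚ.< q ℚ.* t ^ℚ suc k)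

-- For x > 0, as the inverse of exp.
ln : Cut → Cut
ln x = cut (λ q → exp q < x) (λ q → x < exp q)

fromℚ-isDedekind : ∀ p → IsDedekind (fromℚ p)
fromℚ-isDedekind p = record
  { L-inhabited = p ℚ.- 1ℚ , below
  ; U-inhabited = p ℚ.+ 1ℚ , above
  ; L-lower     = ℚ.<-trans
  ; U-upper     = λ q<r p<q → ℚ.<-trans p<q q<r
  ; L-open      = ℚ.<-dense
  ; U-open      = λ p<r → let (m , p<m , m<r) = ℚ.<-dense p<r in m , m<r , p<m
  ; disjoint    = ℚ.<-asym
  ; located     = located
  }
  where
  below : p ℚ.- 1ℚ ℚ.< p
  below = subst (p ℚ.- 1ℚ ℚ.<_) (ℚ.+-identityʳ p)
            (ℚ.+-monoʳ-< p (ℚ.negative⁻¹ (ℚ.- 1ℚ)))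

  above : p ℚ.< p ℚ.+ 1ℚ
  above = subst (ℚ._< p ℚ.+ 1ℚ) (ℚ.+-identityʳ p)
            (ℚ.+-monoʳ-< p (ℚ.positive⁻¹ 1ℚ))

  located : ∀ {q r} → q ℚ.< r → q ℚ.< p ⊎ p ℚ.< r
  located {q} q<r with q ℚ.<? p
  ... | yes q<p = inj₁ q<p
  ... | no  q≮p = inj₂ (ℚ.≤-<-trans (ℚ.≮⇒≥ q≮p) q<r)

{-# OPTIONS --safe #-}
-- Greedily choose m triples of [n], each time one contained in at least the
-- average number of the k-sets that contain no chosen triple yet.  The number
-- of these k-sets drops by the factor 1 - C(k,3) / C(n,3) in every step, so it
-- reaches 0 once C(n,k) (1 - C(k,3) / C(n,3)) ^ m < 1, for which m of the order
-- of (n / k)³ k ln n suffices.  For k of the order of √(ln n) n ^ ((3 - s) / 2)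
-- this is of the order of n ^ s, and the sum of the chosen monomials is the
-- function f.  To choose k and m constructively, s is enclosed between rationals
-- a / D and (a + 2) / D with D = 8 n, n ^ (a / D) is rounded down to a natural
-- number M, and ln n is replaced by w² for the largest w with 4 ^ w² < n.
module Submission where

open import Algebra.Bundles using (CommutativeRing)
import Algebra.Properties.CommutativeSemiring.Exp as Exp
open import Data.Bool using (T?)
open import Data.Bool.Base using (Bool; true; false; _∨_; _xor_; not; if_then_else_)
import Data.Bool.Properties as Bool
open import Data.Empty using (⊥-elim)
open import Data.Fin.Subset using (Subset; inside; outside; Nonempty; ∣_∣; ⊤)
open import Data.Fin.Subset.Properties using (∣⊤∣≡n)
open import Data.Integer.Base as ℤ using (+_)
import Data.Integer.Properties as ℤ
open import Data.List.Base using (List; []; _∷_; _++_; map; filter; filterᵇ; length)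
open import Data.List.Extrema.Nat using (min≤⊤)
open import Data.List.Membership.Propositional using (_∈_)
open import Data.List.Membership.Propositional.Properties using (∈-++⁺ˡ; ∈-++⁺ʳ; ∈-map⁺; ∈-filter⁺)
open import Data.List.Properties using (++-identityʳ)
open import Data.List.Relation.Unary.All as All using (All; []; _∷_)
open import Data.List.Relation.Unary.Any using (here; there)
open import Data.Nat.Base as ℕ using (ℕ; zero; suc; s≤s; z≤n; NonZero; _/_)
open import Data.Nat.Combinatorics using (_C_; nCk+nC[k+1]≡[n+1]C[k+1]; nC1≡n)
open import Data.Nat.DivMod using (m≡m%n+[m/n]*n; m%n<n; m/n*n≤m)
import Data.Nat.Properties as ℕ
open import Data.Nat.Solver using (module +-*-Solver)
open import Data.Product.Base using (∃-syntax; _×_; _,_; proj₁; proj₂)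
open import Data.Rational.Base as ℚ using (ℚ; 0ℚ; 1ℚ; ½; fromℚᵘ)
import Data.Rational.Properties as ℚ
import Data.Rational.Solver as ℚ
open import Data.Rational.Unnormalised.Base as ℚᵘ using (mkℚᵘ; *≡*; *<*)
import Data.Rational.Unnormalised.Properties as ℚᵘ
open import Data.Sum.Base using (inj₁; inj₂)
open import Data.Vec.Base using ([]; _∷_)
open import Function.Base using (_∘_)
open import Function.Bundles using (Equivalence)
open import Relation.Binary.PropositionalEquality
open import Relation.Nullary using (¬_; yes; no)
open import Relation.Nullary.Decidable using (from-yes)
open import Relation.Unary using (Decidable)
open import Defs

open Cut
open Exp (CommutativeRing.commutativeSemiring ℚ.+-*-commutativeRing) using ()
  renaming (^-distrib-* to ^ℚ-distrib-*)
open +-*-Solver using (solve; _:=_; _:+_; _:*_; con)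
open ℚ.+-*-Solver using () renaming
  (solve to solveℚ; _:=_ to _⩦_; _:+_ to _⊕_; _:*_ to _⊗_; _:-_ to _⊖_; con to conℚ)

-- The constants balance as follows. Let κ be at least the threshold. As w² < ln n, 2 w lies below 3
-- √(ln n), so κ is above 2 w n ^ ((3 - s) / 2). The enclosure of s costs n ^ (2 / D) ≤ 5 / 4, and n
-- ^ (a / D) < M + 1, so (κ + 1)² (M + 1) exceeds 2² / (5 / 4) w² n³ = 16 / 5 w² n³. This is the
-- negation of `TooSmall`. On the other side n < 2 ^ v with v about 2 w². Emptying the family takes
-- v k halvings of about (n / k)³ steps each, so k² M has to be about v n³, that is, 2 w² n³. The
-- gap between 2 and 16 / 5 pays for replacing v by a multiple of w², (k + 1)² by (k - 1) (k - 2),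
-- and M by a multiple of v k. Inequalities between cuts cannot be decided. Hence w, M, k and m are
-- found by deciding statements about natural numbers, and the cuts meet them in two implications
-- only: M bounds the thickness by n ^ s, and a size above the threshold is not `TooSmall`.

private variable
  A B : Set
  n : ℕ

-- Finite sums over lists.

∑ : List A → (A → ℕ) → ℕ
∑ []       g = 0
∑ (x ∷ xs) g = g x ℕ.+ ∑ xs g

𝟙 : Bool → ℕ
𝟙 b = if b then 1 else 0

∑-cong : ∀ (xs : List A) {g h : A → ℕ} → (∀ x → g x ≡ h x) → ∑ xs g ≡ ∑ xs h
∑-cong []       eq = refl
∑-cong (x ∷ xs) eq = cong₂ ℕ._+_ (eq x) (∑-cong xs eq)

∑-mono : ∀ (xs : List A) {g h : A → ℕ} → (∀ x → g x ℕ.≤ h x) → ∑ xs g ℕ.≤ ∑ xs h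
∑-mono []       le = z≤n
∑-mono (x ∷ xs) le = ℕ.+-mono-≤ (le x) (∑-mono xs le)

∑-zero : ∀ (xs : List A) → ∑ xs (λ _ → 0) ≡ 0
∑-zero []       = refl
∑-zero (x ∷ xs) = ∑-zero xs

∑-+ : ∀ (xs : List A) (g h : A → ℕ) → ∑ xs (λ x → g x ℕ.+ h x) ≡ ∑ xs g ℕ.+ ∑ xs h
∑-+ []       g h = refl
∑-+ (x ∷ xs) g h = trans (cong (g x ℕ.+ h x ℕ.+_) (∑-+ xs g h))
  (solve 4 (λ a b c d → (a :+ b) :+ (c :+ d) := (a :+ c) :+ (b :+ d)) refl
    (g x) (h x) (∑ xs g) (∑ xs h))

∑-++ : ∀ (xs ys : List A) g → ∑ (xs ++ ys) g ≡ ∑ xs g ℕ.+ ∑ ys g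
∑-++ []       ys g = refl
∑-++ (x ∷ xs) ys g = trans (cong (g x ℕ.+_) (∑-++ xs ys g)) (sym (ℕ.+-assoc (g x) _ _))

∑-map : ∀ (xs : List B) (h : B → A) g → ∑ (map h xs) g ≡ ∑ xs (λ x → g (h x))
∑-map []       h g = refl
∑-map (x ∷ xs) h g = cong (g (h x) ℕ.+_) (∑-map xs h g)

∑-swap : ∀ (xs : List A) (ys : List B) (g : A → B → ℕ) →
  ∑ xs (λ x → ∑ ys (g x)) ≡ ∑ ys (λ y → ∑ xs (λ x → g x y))
∑-swap []       ys g = sym (∑-zero ys)
∑-swap (x ∷ xs) ys g = trans (cong (∑ ys (g x) ℕ.+_) (∑-swap xs ys g)) (sym (∑-+ ys _ _))

∑-const : ∀ {xs : List A} {g : A → ℕ} {c} → All (λ x → g x ≡ c) xs → ∑ xs g ≡ length xs ℕ.* c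
∑-const []         = refl
∑-const (eq ∷ eqs) = cong₂ ℕ._+_ eq (∑-const eqs)

∑-filterᵇ : ∀ (p : A → Bool) xs g → ∑ (filterᵇ p xs) g ≡ ∑ xs (λ x → 𝟙 (p x) ℕ.* g x)
∑-filterᵇ p []       g = refl
∑-filterᵇ p (x ∷ xs) g with p x
... | true  = cong₂ ℕ._+_ (sym (ℕ.+-identityʳ (g x))) (∑-filterᵇ p xs g)
... | false = ∑-filterᵇ p xs g

length-filterᵇ : ∀ (p : A → Bool) xs → length (filterᵇ p xs) ≡ ∑ xs (λ x → 𝟙 (p x))
length-filterᵇ p []       = refl
length-filterᵇ p (x ∷ xs) with p x
... | true  = cong suc (length-filterᵇ p xs)
... | false = length-filterᵇ p xs

length-filterᵇ-not : ∀ (p : A → Bool) xs →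
  length (filterᵇ (λ x → not (p x)) xs) ℕ.+ ∑ xs (λ x → 𝟙 (p x)) ≡ length xs
length-filterᵇ-not p []       = refl
length-filterᵇ-not p (x ∷ xs) with p x
... | true  = trans (ℕ.+-suc _ _) (cong suc (length-filterᵇ-not p xs))
... | false = cong suc (length-filterᵇ-not p xs)

All-filterᵇ : ∀ (p : A → Bool) xs → All (λ x → p x ≡ true) (filterᵇ p xs)
All-filterᵇ p []       = []
All-filterᵇ p (x ∷ xs) with p x in eq
... | true  = eq ∷ All-filterᵇ p xs
... | false = All-filterᵇ p xs

filterᵇ⁺ : ∀ {P : A → Set} (p : A → Bool) {xs} → All P xs → All P (filterᵇ p xs)
filterᵇ⁺ p {[]}     [] = []
filterᵇ⁺ p {x ∷ xs} (px ∷ pxs) with p x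
... | true  = px ∷ filterᵇ⁺ p pxs
... | false = filterᵇ⁺ p pxs

average : ∀ (x : A) xs (g : A → ℕ) →
  ∃[ y ] y ∈ x ∷ xs × ∑ (x ∷ xs) g ℕ.≤ length (x ∷ xs) ℕ.* g y
average x []       g = x , here refl , ℕ.≤-refl
average x (z ∷ zs) g with average z zs g
... | y , y∈ , le with ℕ.≤-total (g x) (g y)
...   | inj₁ x≤y = y , there y∈ , ℕ.+-mono-≤ x≤y le

...   | inj₂ y≤x = x , here refl , ℕ.+-monoʳ-≤ (g x) (ℕ.≤-trans le (ℕ.*-monoʳ-≤ (length (z ∷ zs)) y≤x))

-- Subsets of a fixed size.

∑-subsets : ∀ n (g : Subset (suc n) → ℕ) →
  ∑ (subsets (suc n)) g ≡
    ∑ (subsets n) (λ S → g (outside ∷ S)) ℕ.+ ∑ (subsets n) (λ S → g (inside ∷ S))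
∑-subsets n g = begin
  ∑ (map (outside ∷_) Ss ++ map (inside ∷_) Ss ++ []) g
    ≡⟨ cong (λ ys → ∑ (map (outside ∷_) Ss ++ ys) g) (++-identityʳ _) ⟩
  ∑ (map (outside ∷_) Ss ++ map (inside ∷_) Ss) g
    ≡⟨ ∑-++ (map (outside ∷_) Ss) _ g ⟩
  ∑ (map (outside ∷_) Ss) g ℕ.+ ∑ (map (inside ∷_) Ss) g
    ≡⟨ cong₂ ℕ._+_ (∑-map Ss (outside ∷_) g) (∑-map Ss (inside ∷_) g) ⟩
  ∑ Ss (λ S → g (outside ∷ S)) ℕ.+ ∑ Ss (λ S → g (inside ∷ S)) ∎
  where
  open ≡-Reasoning
  Ss = subsets n

hasSize : ℕ → Subset n → Bool
hasSize j S = ∣ S ∣ ℕ.≡ᵇ j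

sized : ∀ n → ℕ → List (Subset n)
sized n j = filterᵇ (hasSize j) (subsets n)

-- The monomial of S at the indicator vector of K tells whether S ⊆ K.
∑-monomial : ∀ j (K : Subset n) →
  ∑ (sized n j) (λ S → 𝟙 (monomial S K)) ≡ ∣ K ∣ C j
∑-monomial {n} j K = trans (∑-filterᵇ (hasSize j) (subsets n) _) (go j K)
  where
  go : ∀ {n} j (K : Subset n) →
    ∑ (subsets n) (λ S → 𝟙 (hasSize j S) ℕ.* 𝟙 (monomial S K)) ≡ ∣ K ∣ C j
  go zero    [] = refl
  go (suc j) [] = refl
  go {suc n} zero (b ∷ K) = trans (∑-subsets n _)
    (trans (cong₂ ℕ._+_ (go zero K) (∑-zero (subsets n))) refl)
  go {suc n} (suc j) (inside ∷ K) = trans (∑-subsets n _)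
    (trans (cong₂ ℕ._+_ (go (suc j) K) (go j K))
      (trans (ℕ.+-comm (∣ K ∣ C suc j) _) (nCk+nC[k+1]≡[n+1]C[k+1] ∣ K ∣ j)))
  go {suc n} (suc j) (outside ∷ K) = trans (∑-subsets n _)
    (trans (cong₂ ℕ._+_ (go (suc j) K)
        (trans (∑-cong (subsets n) (λ S → ℕ.*-zeroʳ (𝟙 (hasSize j S)))) (∑-zero (subsets n))))
      (ℕ.+-identityʳ _))

monomial-⊤ : ∀ (S : Subset n) → monomial S ⊤ ≡ true
monomial-⊤ []            = refl
monomial-⊤ (inside  ∷ S) = monomial-⊤ S
monomial-⊤ (outside ∷ S) = monomial-⊤ S

∑-length : ∀ (xs : List A) → ∑ xs (λ _ → 1) ≡ length xs
∑-length []       = refl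
∑-length (x ∷ xs) = cong suc (∑-length xs)

length-sized : ∀ n j → length (sized n j) ≡ n C j
length-sized n j = begin
  length (sized n j)                          ≡⟨ ∑-length (sized n j) ⟨
  ∑ (sized n j) (λ _ → 1)                     ≡⟨ ∑-cong (sized n j) (λ S → cong 𝟙 (sym (monomial-⊤ S))) ⟩
  ∑ (sized n j) (λ S → 𝟙 (monomial S ⊤))      ≡⟨ ∑-monomial j (⊤ {n}) ⟩
  ∣ ⊤ {n} ∣ C j                               ≡⟨ cong (_C j) (∣⊤∣≡n n) ⟩
  n C j                                       ∎
  where open ≡-Reasoning

sized-size : ∀ n j → All (λ S → ∣ S ∣ ≡ j) (sized n j)
sized-size n j = All.map (λ {S} eq → ℕ.≡ᵇ⇒≡ ∣ S ∣ j (Equivalence.from Bool.T-≡ eq))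
  (All-filterᵇ (hasSize j) (subsets n))


∈-subsets : ∀ (S : Subset n) → S ∈ subsets n
∈-subsets []      = here refl
∈-subsets (outside ∷ S) = ∈-++⁺ˡ (∈-map⁺ (outside ∷_) (∈-subsets S))
∈-subsets (inside ∷ S) = ∈-++⁺ʳ (map (outside ∷_) (subsets _)) (∈-++⁺ˡ (∈-map⁺ (inside ∷_) (∈-subsets S)))

∈-sized : ∀ {j} (S : Subset n) → ∣ S ∣ ≡ j → S ∈ sized n j
∈-sized {j = j} S eq = ∈-filter⁺ (λ S → T? (hasSize j S)) (∈-subsets S) (ℕ.≡⇒≡ᵇ ∣ S ∣ j eq)

_≡ᵇ_ : Subset n → Subset n → Bool
[]            ≡ᵇ []            = true
(outside ∷ S) ≡ᵇ (outside ∷ T) = S ≡ᵇ T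
(outside ∷ S) ≡ᵇ (inside  ∷ T) = false
(inside  ∷ S) ≡ᵇ (outside ∷ T) = false
(inside  ∷ S) ≡ᵇ (inside  ∷ T) = S ≡ᵇ T

≡ᵇ-refl : ∀ (S : Subset n) → (S ≡ᵇ S) ≡ true
≡ᵇ-refl []            = refl
≡ᵇ-refl (outside ∷ S) = ≡ᵇ-refl S
≡ᵇ-refl (inside  ∷ S) = ≡ᵇ-refl S

≡ᵇ⇒≡ : ∀ (S T : Subset n) → (S ≡ᵇ T) ≡ true → S ≡ T
≡ᵇ⇒≡ []            []            eq = refl
≡ᵇ⇒≡ (outside ∷ S) (outside ∷ T) eq = cong (outside ∷_) (≡ᵇ⇒≡ S T eq)
≡ᵇ⇒≡ (inside  ∷ S) (inside  ∷ T) eq = cong (inside ∷_) (≡ᵇ⇒≡ S T eq)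

∑-≡ᵇ : ∀ (T : Subset n) → ∑ (subsets n) (λ S → 𝟙 (S ≡ᵇ T)) ≡ 1
∑-≡ᵇ [] = refl
∑-≡ᵇ {suc n} (outside ∷ T) = trans (∑-subsets n _) (cong₂ ℕ._+_ (∑-≡ᵇ T) (∑-zero (subsets n)))
∑-≡ᵇ {suc n} (inside  ∷ T) = trans (∑-subsets n _) (cong₂ ℕ._+_ (∑-zero (subsets n)) (∑-≡ᵇ T))

𝟙-∨ : ∀ a b → 𝟙 (a ∨ b) ℕ.≤ 𝟙 a ℕ.+ 𝟙 b
𝟙-∨ true  b = ℕ.m≤m+n 1 (𝟙 b)
𝟙-∨ false b = ℕ.≤-refl

-- Greedy choice of a small family that hits all k-sets.

module Greedy (n j k : ℕ) where

  Hits : (Subset n → Bool) → Subset n → Set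
  Hits c K = ∃[ S ] c S ≡ true × monomial S K ≡ true

  N  = n C j
  N′ = n C j ℕ.∸ k C j

  -- By double counting the pairs S ⊆ K with K in F.
  best : 0 ℕ.< N → ∀ {F} → All (λ K → ∣ K ∣ ≡ k) F →
    ∃[ S ] ∣ S ∣ ≡ j × N ℕ.* length (filterᵇ (λ K → not (monomial S K)) F) ℕ.≤ N′ ℕ.* length F
  best 0<N {F} sizes with sized n j | length-sized n j | sized-size n j | ∑-monomial {n} j
  ... | []     | len | _    | _   = ⊥-elim (ℕ.<-irrefl len 0<N)
  ... | T ∷ Ts | len | szTs | mon with average T Ts (λ S → ∑ F (λ K → 𝟙 (monomial S K)))
  -- The added term `(k C j) * length F` counts the pairs S ⊆ K. It is at most N h for the chosen S,
  -- and u + h is the length of `F`.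
  ...   | S , S∈ , avg = S , All.lookup szTs S∈ , ℕ.+-cancelʳ-≤ ((k C j) ℕ.* length F) _ _ (begin
    N ℕ.* u ℕ.+ (k C j) ℕ.* length F
      ≡⟨ cong (N ℕ.* u ℕ.+_) (ℕ.*-comm (k C j) _) ⟩
    N ℕ.* u ℕ.+ length F ℕ.* (k C j)
      ≡⟨ cong (N ℕ.* u ℕ.+_) (sym (∑-const (All.map (λ {K} eq → trans (mon K) (cong (_C j) eq)) sizes))) ⟩
    N ℕ.* u ℕ.+ ∑ F (λ K → ∑ (T ∷ Ts) (λ S → 𝟙 (monomial S K)))
      ≡⟨ cong (N ℕ.* u ℕ.+_) (∑-swap F (T ∷ Ts) _) ⟩
    N ℕ.* u ℕ.+ ∑ (T ∷ Ts) (λ S → ∑ F (λ K → 𝟙 (monomial S K)))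
      ≤⟨ ℕ.+-monoʳ-≤ (N ℕ.* u) avg ⟩
    N ℕ.* u ℕ.+ length (T ∷ Ts) ℕ.* h
      ≡⟨ cong (λ l → N ℕ.* u ℕ.+ l ℕ.* h) len ⟩
    N ℕ.* u ℕ.+ N ℕ.* h
      ≡⟨ sym (ℕ.*-distribˡ-+ N u h) ⟩
    N ℕ.* (u ℕ.+ h)
      ≡⟨ cong (N ℕ.*_) (length-filterᵇ-not (monomial S) F) ⟩
    N ℕ.* length F
      ≤⟨ ℕ.*-monoˡ-≤ (length F) (ℕ.m≤n+m∸n N (k C j)) ⟩
    (k C j ℕ.+ N′) ℕ.* length F
      ≡⟨ ℕ.*-distribʳ-+ (length F) (k C j) N′ ⟩
    (k C j) ℕ.* length F ℕ.+ N′ ℕ.* length F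
      ≡⟨ ℕ.+-comm ((k C j) ℕ.* length F) _ ⟩
    N′ ℕ.* length F ℕ.+ (k C j) ℕ.* length F ∎)
    where
    open ℕ.≤-Reasoning
    u = length (filterᵇ (λ K → not (monomial S K)) F)
    h = ∑ F (λ K → 𝟙 (monomial S K))

  -- The sets containing `S` are hit by `S` itself; the others keep their old hit, as `c′` extends
  -- `c`.
  unhit⇒hit : ∀ {c c′ : Subset n → Bool} {S} F →
    (∀ T → c T ≡ true → c′ T ≡ true) → c′ S ≡ true →
    All (Hits c) (filterᵇ (λ K → not (monomial S K)) F) → All (Hits c′) F
  unhit⇒hit []      mono new hits = []
  unhit⇒hit {S = S} (K ∷ F) mono new hits with monomial S K in eq
  ... | true  = (S , new , eq) ∷ unhit⇒hit F mono new hits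
  unhit⇒hit {S = S} (K ∷ F) mono new ((T , cT , mT) ∷ hits) | false =
    (T , mono T cT , mT) ∷ unhit⇒hit F mono new hits

  -- The strict inequality is an invariant: `best` shrinks `F` at least by the factor N′ / N, and
  -- cancelling one N leaves the inequality for m. At m = 0 it says that `F` has fewer than one
  -- member.
  cover : 0 ℕ.< N → ∀ m F → All (λ K → ∣ K ∣ ≡ k) F →
    length F ℕ.* N′ ℕ.^ m ℕ.< N ℕ.^ m →
    ∃[ c ] ∑ (subsets n) (λ S → 𝟙 (c S)) ℕ.≤ m ×
      (∀ S → c S ≡ true → ∣ S ∣ ≡ j) × All (Hits c) F
  cover 0<N zero [] sizes lt =
    (λ _ → false) , ℕ.≤-reflexive (∑-zero (subsets n)) , (λ S ()) , []
  cover 0<N zero (K ∷ F) sizes lt = ⊥-elim (ℕ.≤⇒≯ (s≤s z≤n) lt)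
  cover 0<N (suc m) F sizes lt with best 0<N sizes
  ... | T , ∣T∣≡j , few with cover 0<N m _ (filterᵇ⁺ _ sizes) (ℕ.*-cancelˡ-< N _ _ (begin-strict
      N ℕ.* (u ℕ.* N′ ℕ.^ m)        ≡⟨ ℕ.*-assoc N u _ ⟨
      N ℕ.* u ℕ.* N′ ℕ.^ m          ≤⟨ ℕ.*-monoˡ-≤ (N′ ℕ.^ m) few ⟩
      N′ ℕ.* length F ℕ.* N′ ℕ.^ m  ≡⟨ solve 3 (λ a b c → a :* b :* c := b :* (a :* c)) refl N′ (length F) _ ⟩
      length F ℕ.* N′ ℕ.^ suc m     <⟨ lt ⟩
      N ℕ.^ suc m                   ∎))
    where
    open ℕ.≤-Reasoning
    u = length (filterᵇ (λ K → not (monomial T K)) F)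
  ...   | c , few′ , sz , hits = c′ , count , size ,
      unhit⇒hit F (λ S eq → trans (cong ((S ≡ᵇ T) ∨_) eq) (Bool.∨-zeroʳ _))
        (cong (_∨ c T) (≡ᵇ-refl T)) hits
    where
    c′ : Subset n → Bool
    c′ S = (S ≡ᵇ T) ∨ c S

    count : ∑ (subsets n) (λ S → 𝟙 (c′ S)) ℕ.≤ suc m
    count = ℕ.≤-trans (∑-mono (subsets n) (λ S → 𝟙-∨ (S ≡ᵇ T) (c S)))
      (ℕ.≤-trans (ℕ.≤-reflexive (trans (∑-+ (subsets n) _ _) (cong (ℕ._+ _) (∑-≡ᵇ T)))) (s≤s few′))

    size : ∀ S → c′ S ≡ true → ∣ S ∣ ≡ j
    size S eq with S ≡ᵇ T in S≡T
    ... | true  = trans (cong ∣_∣ (≡ᵇ⇒≡ S T S≡T)) ∣T∣≡j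
    ... | false = sz S eq

-- Homogeneous polynomials: thickness, degree and restrictions.

coeff-⟦⟧ : ∀ (c : Subset n → Bool) S → coeff ⟦ c ⟧ S ≡ c S
coeff-⟦⟧ c S = sym (coeff-unique ⟦ c ⟧ c (λ _ → refl) S)

-- The default value of the minimum stands for the identity map.
thickness-≤ : ∀ (f : BoolFun n) → thickness f ℕ.≤ ‖ f ‖
thickness-≤ {n} f = min≤⊤ ‖ f ‖ (map (λ A → ‖ f ∘ apply A ‖) (filter bijective? (affines n)))

thickness-⟦⟧ : ∀ (c : Subset n → Bool) → thickness ⟦ c ⟧ ℕ.≤ ∑ (subsets n) (λ S → 𝟙 (c S))
thickness-⟦⟧ {n} c = ℕ.≤-trans (thickness-≤ ⟦ c ⟧) (ℕ.≤-reflexive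
  (trans (length-filterᵇ (coeff ⟦ c ⟧) (subsets n))
         (∑-cong (subsets n) (λ S → cong 𝟙 (coeff-⟦⟧ c S)))))

-- Setting variables to 0 deletes the monomials that contain them and changes no other coefficient.
-- Subsets being bit vectors, `extend K` also turns a set of positions within `K` into a subset of
-- [n].
coeff-restrict : ∀ (f : BoolFun n) K S → coeff (restrict f K) S ≡ coeff f (extend K S)
coeff-restrict f []            []            = refl
coeff-restrict f (outside ∷ K) S             = coeff-restrict (λ x → f (false ∷ x)) K S
coeff-restrict f (inside  ∷ K) (outside ∷ S) = coeff-restrict (λ x → f (false ∷ x)) K S
coeff-restrict f (inside  ∷ K) (inside  ∷ S) =
  coeff-restrict (λ x → f (false ∷ x) xor f (true ∷ x)) K S

∣extend∣ : ∀ (K : Subset n) S → ∣ extend K S ∣ ≡ ∣ S ∣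
∣extend∣ []            []            = refl
∣extend∣ (outside ∷ K) S             = ∣extend∣ K S
∣extend∣ (inside  ∷ K) (outside ∷ S) = ∣extend∣ K S
∣extend∣ (inside  ∷ K) (inside  ∷ S) = cong suc (∣extend∣ K S)

extend-surjective : ∀ (K S : Subset n) → monomial S K ≡ true → ∃[ T ] extend K T ≡ S
extend-surjective []            []            eq = [] , refl
extend-surjective (outside ∷ K) (outside ∷ S) eq =
  let T , eqT = extend-surjective K S eq in T , cong (outside ∷_) eqT
extend-surjective (inside ∷ K) (b ∷ S) eq =
  let T , eqT = extend-surjective K S (tail b eq) in b ∷ T , cong (b ∷_) eqT
  where
  tail : ∀ b → monomial (b ∷ S) (inside ∷ K) ≡ true → monomial S K ≡ true
  tail inside  eq = eq
  tail outside eq = eq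

-- All monomials have the same size, so a single one that survives inside `K` fixes the degree.
restrict-hasDegree : ∀ (c : Subset n → Bool) {d} → (∀ S → c S ≡ true → ∣ S ∣ ≡ d) →
  ∀ K S → c S ≡ true → monomial S K ≡ true → HasDegree (restrict ⟦ c ⟧ K) d
restrict-hasDegree c size K S cS S⊆K with extend-surjective K S S⊆K
... | T , refl = (T , trans (coeff′ T) cS , trans (sym (∣extend∣ K T)) (size _ cS)) ,
  λ T′ eq → ℕ.≤-reflexive (trans (sym (∣extend∣ K T′)) (size _ (trans (sym (coeff′ T′)) eq)))
  where
  coeff′ : ∀ T → coeff (restrict ⟦ c ⟧ K) T ≡ c (extend K T)
  coeff′ T = trans (coeff-restrict ⟦ c ⟧ K T) (coeff-⟦⟧ c (extend K T))

hasDegree : ∀ (c : Subset n → Bool) {d} → (∀ S → c S ≡ true → ∣ S ∣ ≡ d) →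
  ∀ S → c S ≡ true → HasDegree ⟦ c ⟧ d
hasDegree c size S cS = (S , trans (coeff-⟦⟧ c S) cS , size S cS) ,
  λ T eq → ℕ.≤-reflexive (size T (trans (sym (coeff-⟦⟧ c T)) eq))

-- The greedy choice hits sets of size exactly k. A larger `K` inherits the hit from a k-set inside
-- it.
shrink : ∀ k (K : Subset n) → k ℕ.≤ ∣ K ∣ →
  ∃[ K′ ] ∣ K′ ∣ ≡ k × (∀ S → monomial S K′ ≡ true → monomial S K ≡ true)
shrink zero [] le = [] , refl , λ _ eq → eq
shrink k (outside ∷ K) le with shrink k K le
... | K′ , sz , sub = outside ∷ K′ , sz , λ { (outside ∷ S) eq → sub S eq }
shrink zero (inside ∷ K) le with shrink zero K z≤n
... | K′ , sz , sub = outside ∷ K′ , sz , λ { (outside ∷ S) eq → sub S eq }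
shrink (suc k) (inside ∷ K) (s≤s le) with shrink k K le
... | K′ , sz , sub = inside ∷ K′ , cong suc sz ,
  λ { (outside ∷ S) eq → sub S eq ; (inside ∷ S) eq → sub S eq }

sparse-homogeneous : ∀ {n d k m} → 0 ℕ.< n C d → k ℕ.≤ n →
  (n C k) ℕ.* (n C d ℕ.∸ k C d) ℕ.^ m ℕ.< (n C d) ℕ.^ m →
  ∃[ f ] HasDegree {n} f d × thickness f ℕ.≤ m ×
    (∀ K → k ℕ.≤ ∣ K ∣ → HasDegree (restrict f K) d)
sparse-homogeneous {n} {d} {k} {m} 0<N k≤n lt
  with cover 0<N m (sized n k) (sized-size n k)
         (subst (λ l → l ℕ.* N′ ℕ.^ m ℕ.< N ℕ.^ m) (sym (length-sized n k)) lt)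
  where open Greedy n d k
... | c , few , size , hits =
  -- The full set has at least k elements and is therefore hit too, which makes the function
  -- nonzero.
  ⟦ c ⟧ , (let S , cS , _ = hit ⊤ (subst (k ℕ.≤_) (sym (∣⊤∣≡n n)) k≤n) in hasDegree c size S cS) ,
  ℕ.≤-trans (thickness-⟦⟧ c) few ,
  λ K le → let S , cS , S⊆K = hit K le in restrict-hasDegree c size K S cS S⊆K
  where
  open Greedy n d k
  hit : ∀ K → k ℕ.≤ ∣ K ∣ → Hits c K
  hit K le with shrink k K le
  ... | K′ , sz , sub with All.lookup hits (∈-sized K′ sz)
  ...   | S , cS , S⊆K′ = S , cS , sub S S⊆K′

-- Search and estimates in the natural numbers.

-- A downward search from the failing end. It supplies the last too small size before k, the square
-- root w of the logarithm, and the rounded power M.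
crossing : ∀ {P : ℕ → Set} → Decidable P → ∀ lo d → P lo → ¬ P (d ℕ.+ lo) →
  ∃[ m ] lo ℕ.≤ m × m ℕ.< d ℕ.+ lo × P m × ¬ P (suc m)
crossing P? lo zero    Plo ¬Phi = ⊥-elim (¬Phi Plo)
crossing P? lo (suc d) Plo ¬Phi with P? (d ℕ.+ lo)
... | yes Pm = d ℕ.+ lo , ℕ.m≤n+m lo d , ℕ.≤-refl , Pm , ¬Phi
... | no ¬Pm with crossing P? lo d Plo ¬Pm
...   | m , lo≤m , m<hi , Pm , ¬Psm = m , lo≤m , ℕ.m<n⇒m<1+n m<hi , Pm , ¬Psm

^-distribʳ-* : ∀ e a b → (a ℕ.* b) ℕ.^ e ≡ a ℕ.^ e ℕ.* b ℕ.^ e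
^-distribʳ-* zero    a b = refl
^-distribʳ-* (suc e) a b = trans (cong (a ℕ.* b ℕ.*_) (^-distribʳ-* e a b))
  (solve 4 (λ a b x y → a :* b :* (x :* y) := a :* x :* (b :* y)) refl a b (a ℕ.^ e) (b ℕ.^ e))

n<2^n : ∀ n → n ℕ.< 2 ℕ.^ n
n<2^n zero    = s≤s z≤n
n<2^n (suc n) = ℕ.≤-trans (ℕ.+-mono-≤ (ℕ.m^n>0 2 n) (n<2^n n))
  (ℕ.≤-reflexive (cong (2 ℕ.^ n ℕ.+_) (sym (ℕ.+-identityʳ _))))

n²≤4^n : ∀ n → n ℕ.* n ℕ.≤ 4 ℕ.^ n
n²≤4^n n = ℕ.≤-trans (ℕ.*-mono-≤ (ℕ.<⇒≤ (n<2^n n)) (ℕ.<⇒≤ (n<2^n n)))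
  (ℕ.≤-reflexive (sym (^-distribʳ-* n 2 2)))

nCk≤n^k : ∀ n k → n C k ℕ.≤ n ℕ.^ k
nCk≤n^k n       zero    = ℕ.≤-refl
nCk≤n^k zero    (suc k) = z≤n
nCk≤n^k (suc n) (suc k) = begin
  suc n C suc k                  ≡⟨ nCk+nC[k+1]≡[n+1]C[k+1] n k ⟨
  n C k ℕ.+ n C suc k            ≤⟨ ℕ.+-mono-≤ (nCk≤n^k n k) (nCk≤n^k n (suc k)) ⟩
  n ℕ.^ k ℕ.+ n ℕ.* n ℕ.^ k      ≡⟨⟩
  suc n ℕ.* n ℕ.^ k              ≤⟨ ℕ.*-monoʳ-≤ (suc n) (ℕ.^-monoˡ-≤ k (ℕ.n≤1+n n)) ⟩
  suc n ℕ.* suc n ℕ.^ k          ∎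
  where open ℕ.≤-Reasoning

-- With `v` above the binary logarithm of n, v k halvings bring the number of k-sets below one.
nCk<2^ : ∀ {n v} → n ℕ.< 2 ℕ.^ v → ∀ k .{{_ : NonZero k}} → n C k ℕ.< 2 ℕ.^ (v ℕ.* k)
nCk<2^ {n} {v} n<2^v k = begin-strict
  n C k              ≤⟨ nCk≤n^k n k ⟩
  n ℕ.^ k            <⟨ ℕ.^-monoˡ-< k n<2^v ⟩
  (2 ℕ.^ v) ℕ.^ k    ≡⟨ ℕ.^-*-assoc 2 v k ⟩
  2 ℕ.^ (v ℕ.* k)    ∎
  where open ℕ.≤-Reasoning

nCk≤[n+1]Ck : ∀ n k → n C k ℕ.≤ suc n C k
nCk≤[n+1]Ck n zero    = ℕ.≤-refl
nCk≤[n+1]Ck n (suc k) = ℕ.≤-trans (ℕ.m≤n+m (n C suc k) (n C k)) (ℕ.≤-reflexive (nCk+nC[k+1]≡[n+1]C[k+1] n k))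

C-monoˡ-≤ : ∀ {m n} k → m ℕ.≤ n → m C k ℕ.≤ n C k
C-monoˡ-≤ {m} {n} k m≤n = go (ℕ.≤⇒≤′ m≤n)
  where
  go : ∀ {n} → m ℕ.≤′ n → m C k ℕ.≤ n C k
  go (ℕ.≤′-reflexive refl) = ℕ.≤-refl
  go (ℕ.≤′-step le)        = ℕ.≤-trans (go le) (nCk≤[n+1]Ck _ k)

2*[1+n]C2 : ∀ n → 2 ℕ.* (suc n C 2) ≡ suc n ℕ.* n
2*[1+n]C2 zero    = refl
2*[1+n]C2 (suc n) = begin
  2 ℕ.* (suc (suc n) C 2)                    ≡⟨ cong (2 ℕ.*_) (nCk+nC[k+1]≡[n+1]C[k+1] (suc n) 1) ⟨
  2 ℕ.* (suc n C 1 ℕ.+ suc n C 2)            ≡⟨ ℕ.*-distribˡ-+ 2 (suc n C 1) _ ⟩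
  2 ℕ.* (suc n C 1) ℕ.+ 2 ℕ.* (suc n C 2)    ≡⟨ cong₂ (λ a b → 2 ℕ.* a ℕ.+ b) (nC1≡n (suc n)) (2*[1+n]C2 n) ⟩
  2 ℕ.* suc n ℕ.+ suc n ℕ.* n                ≡⟨ solve 1 (λ n → con 2 :* (con 1 :+ n) :+ (con 1 :+ n) :* n := (con 2 :+ n) :* (con 1 :+ n)) refl n ⟩
  suc (suc n) ℕ.* suc n                      ∎
  where open ≡-Reasoning

6*[2+n]C3 : ∀ n → 6 ℕ.* (suc (suc n) C 3) ≡ suc (suc n) ℕ.* (suc n ℕ.* n)
6*[2+n]C3 zero    = refl
6*[2+n]C3 (suc n) = begin
  6 ℕ.* (suc (suc (suc n)) C 3)                          ≡⟨ cong (6 ℕ.*_) (nCk+nC[k+1]≡[n+1]C[k+1] (suc (suc n)) 2) ⟨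
  6 ℕ.* (suc (suc n) C 2 ℕ.+ suc (suc n) C 3)            ≡⟨ ℕ.*-distribˡ-+ 6 (suc (suc n) C 2) _ ⟩
  6 ℕ.* (suc (suc n) C 2) ℕ.+ 6 ℕ.* (suc (suc n) C 3)    ≡⟨ cong₂ ℕ._+_ (ℕ.*-assoc 3 2 (suc (suc n) C 2)) (6*[2+n]C3 n) ⟩
  3 ℕ.* (2 ℕ.* (suc (suc n) C 2)) ℕ.+ suc (suc n) ℕ.* (suc n ℕ.* n)
    ≡⟨ cong (λ a → 3 ℕ.* a ℕ.+ suc (suc n) ℕ.* (suc n ℕ.* n)) (2*[1+n]C2 (suc n)) ⟩
  3 ℕ.* (suc (suc n) ℕ.* suc n) ℕ.+ suc (suc n) ℕ.* (suc n ℕ.* n)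
    ≡⟨ solve 1 (λ n → con 3 :* ((con 2 :+ n) :* (con 1 :+ n)) :+ (con 2 :+ n) :* ((con 1 :+ n) :* n)
                    := (con 3 :+ n) :* ((con 2 :+ n) :* (con 1 :+ n))) refl n ⟩
  suc (suc (suc n)) ℕ.* (suc (suc n) ℕ.* suc n)          ∎
  where open ≡-Reasoning

-- Rounding up to the cube is harmless for n. For k the exact product is kept, since its factors are
-- compared with (k + 1)².
6*nC3≤n³ : ∀ n → 6 ℕ.* (n C 3) ℕ.≤ n ℕ.^ 3
6*nC3≤n³ zero          = z≤n
6*nC3≤n³ (suc zero)    = z≤n
6*nC3≤n³ (suc (suc n)) = begin
  6 ℕ.* (suc (suc n) C 3)              ≡⟨ 6*[2+n]C3 n ⟩
  suc (suc n) ℕ.* (suc n ℕ.* n)        ≤⟨ ℕ.*-monoʳ-≤ m (ℕ.*-mono-≤ (ℕ.n≤1+n (suc n)) (ℕ.≤-trans (ℕ.n≤1+n n) (ℕ.n≤1+n (suc n)))) ⟩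
  m ℕ.* (m ℕ.* m)                      ≡⟨ cong (λ z → m ℕ.* (m ℕ.* z)) (ℕ.*-identityʳ m) ⟨
  m ℕ.^ 3                              ∎
  where
  open ℕ.≤-Reasoning
  m = suc (suc n)

-- Bernoulli's inequality (1 + c / d) ^ y ≥ 1 + y c / d, multiplied by d ^ (y + 1).
bernoulli : ∀ d c y → d ℕ.^ y ℕ.* (d ℕ.+ y ℕ.* c) ℕ.≤ d ℕ.* (d ℕ.+ c) ℕ.^ y
bernoulli d c zero    = ℕ.≤-reflexive (solve 1 (λ d → con 1 :* (d :+ con 0) := d :* con 1) refl d)
bernoulli d c (suc y) = begin
  d ℕ.* p ℕ.* (d ℕ.+ (c ℕ.+ y ℕ.* c))
    ≤⟨ ℕ.m≤m+n _ (p ℕ.* (c ℕ.* (y ℕ.* c))) ⟩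
  d ℕ.* p ℕ.* (d ℕ.+ (c ℕ.+ y ℕ.* c)) ℕ.+ p ℕ.* (c ℕ.* (y ℕ.* c))
    ≡⟨ solve 4 (λ d c p z → d :* p :* (d :+ (c :+ z)) :+ p :* (c :* z) := (d :+ c) :* (p :* (d :+ z))) refl d c p (y ℕ.* c) ⟩
  (d ℕ.+ c) ℕ.* (p ℕ.* (d ℕ.+ y ℕ.* c))
    ≤⟨ ℕ.*-monoʳ-≤ (d ℕ.+ c) (bernoulli d c y) ⟩
  (d ℕ.+ c) ℕ.* (d ℕ.* (d ℕ.+ c) ℕ.^ y)
    ≡⟨ solve 3 (λ a d q → a :* (d :* q) := d :* (a :* q)) refl (d ℕ.+ c) d _ ⟩
  d ℕ.* (d ℕ.+ c) ℕ.^ suc y ∎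
  where
  open ℕ.≤-Reasoning
  p = d ℕ.^ y

-- Bernoulli's inequality with y c / d ≥ 1. For d = 0 the left side vanishes because y is positive.
halving : ∀ d c y → 0 ℕ.< y → d ℕ.≤ y ℕ.* c → 2 ℕ.* d ℕ.^ y ℕ.≤ (d ℕ.+ c) ℕ.^ y
halving zero      c (suc y) 0<y le = z≤n
halving d@(suc _) c y       0<y le = ℕ.*-cancelˡ-≤ d (begin
  d ℕ.* (2 ℕ.* d ℕ.^ y)              ≡⟨ solve 2 (λ d p → d :* (con 2 :* p) := p :* (d :+ d)) refl d (d ℕ.^ y) ⟩
  d ℕ.^ y ℕ.* (d ℕ.+ d)              ≤⟨ ℕ.*-monoʳ-≤ (d ℕ.^ y) (ℕ.+-monoʳ-≤ d le) ⟩
  d ℕ.^ y ℕ.* (d ℕ.+ y ℕ.* c)        ≤⟨ bernoulli d c y ⟩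
  d ℕ.* (d ℕ.+ c) ℕ.^ y              ∎)
  where open ℕ.≤-Reasoning

-- N ≤ y c makes (N - c) ^ y at most half of N ^ y.
decay : ∀ {N c e x} y → 0 ℕ.< N → c ℕ.≤ N → N ℕ.≤ y ℕ.* c → x ℕ.< 2 ℕ.^ e →
  x ℕ.* (N ℕ.∸ c) ℕ.^ (y ℕ.* e) ℕ.< N ℕ.^ (y ℕ.* e)
decay {N} {c} {e} {x} y 0<N c≤N le x<2^e = begin-strict
  x ℕ.* d ℕ.^ (y ℕ.* e)          ≡⟨ cong (x ℕ.*_) (ℕ.^-*-assoc d y e) ⟨
  x ℕ.* (d ℕ.^ y) ℕ.^ e          <⟨ shrunk ((d ℕ.^ y) ℕ.^ e) refl ⟩
  (N ℕ.^ y) ℕ.^ e                ≡⟨ ℕ.^-*-assoc N y e ⟩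
  N ℕ.^ (y ℕ.* e)                ∎
  where
  open ℕ.≤-Reasoning
  d = N ℕ.∸ c

  instance
    _ : NonZero N
    _ = ℕ.>-nonZero 0<N
    _ : NonZero (N ℕ.^ y)
    _ = ℕ.m^n≢0 N y

  0<y : ∀ y → N ℕ.≤ y ℕ.* c → 0 ℕ.< y
  0<y zero    N≤0 = ℕ.≤-trans 0<N N≤0
  0<y (suc y) _   = s≤s z≤n

  halved : 2 ℕ.* d ℕ.^ y ℕ.≤ N ℕ.^ y
  halved = subst (λ z → 2 ℕ.* d ℕ.^ y ℕ.≤ z ℕ.^ y) (ℕ.m∸n+n≡m c≤N)
    (halving d c y (0<y y le) (ℕ.≤-trans (ℕ.m∸n≤m N c) le))

  -- Multiplication by q preserves strictness only for positive q. The case q = 0 can occur when c =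
  -- N, and then it is enough that the right side is positive.
  shrunk : ∀ q → q ≡ (d ℕ.^ y) ℕ.^ e → x ℕ.* q ℕ.< (N ℕ.^ y) ℕ.^ e
  shrunk zero      eq = ℕ.≤-trans (s≤s (ℕ.≤-reflexive (ℕ.*-zeroʳ x))) (ℕ.m^n>0 (N ℕ.^ y) e)
  shrunk q@(suc _) eq = begin-strict
    x ℕ.* q                        <⟨ ℕ.*-monoˡ-< q x<2^e ⟩
    2 ℕ.^ e ℕ.* q                  ≡⟨ cong (2 ℕ.^ e ℕ.*_) eq ⟩
    2 ℕ.^ e ℕ.* (d ℕ.^ y) ℕ.^ e    ≡⟨ ^-distribʳ-* e 2 (d ℕ.^ y) ⟨
    (2 ℕ.* d ℕ.^ y) ℕ.^ e          ≤⟨ ℕ.^-monoˡ-≤ e halved ⟩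
    (N ℕ.^ y) ℕ.^ e                ∎

-- The choice of k and m.

-- The constants match exactly: 16 / 5 * 5 / 6 * 7 / 8 = 7 / 3. In this order they come from
-- `TooSmall`, from (k + 1)² against (k - 1) (k - 2), from the rounding of M / (v k), and from v
-- against w².
rescale : ∀ {W x m s a v k y} .{{_ : NonZero W}} →
  16 ℕ.* (W ℕ.* x) ℕ.≤ 5 ℕ.* (s ℕ.* m) → 5 ℕ.* s ℕ.≤ 6 ℕ.* a →
  7 ℕ.* m ℕ.≤ 8 ℕ.* (y ℕ.* (v ℕ.* k)) → 3 ℕ.* v ℕ.≤ 7 ℕ.* W →
  x ℕ.≤ y ℕ.* (k ℕ.* a)
rescale {W} {x} {m} {s} {a} {v} {k} {y} p₁ p₂ p₃ p₄ =
  ℕ.*-cancelˡ-≤ W (ℕ.*-cancelˡ-≤ 16 (ℕ.*-cancelˡ-≤ 7 (begin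
    7 ℕ.* (16 ℕ.* (W ℕ.* x))                      ≤⟨ ℕ.*-monoʳ-≤ 7 p₁ ⟩
    7 ℕ.* (5 ℕ.* (s ℕ.* m))                       ≡⟨ solve 2 (λ s m → con 7 :* (con 5 :* (s :* m)) := con 7 :* (con 5 :* s :* m)) refl s m ⟩
    7 ℕ.* (5 ℕ.* s ℕ.* m)                         ≤⟨ ℕ.*-monoʳ-≤ 7 (ℕ.*-monoˡ-≤ m p₂) ⟩
    7 ℕ.* (6 ℕ.* a ℕ.* m)                         ≡⟨ solve 2 (λ a m → con 7 :* (con 6 :* a :* m) := con 6 :* a :* (con 7 :* m)) refl a m ⟩
    6 ℕ.* a ℕ.* (7 ℕ.* m)                         ≤⟨ ℕ.*-monoʳ-≤ (6 ℕ.* a) p₃ ⟩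
    6 ℕ.* a ℕ.* (8 ℕ.* (y ℕ.* (v ℕ.* k)))         ≡⟨ solve 4 (λ a y v k → con 6 :* a :* (con 8 :* (y :* (v :* k))) := con 16 :* (con 3 :* v :* (y :* (k :* a)))) refl a y v k ⟩
    16 ℕ.* (3 ℕ.* v ℕ.* (y ℕ.* (k ℕ.* a)))        ≤⟨ ℕ.*-monoʳ-≤ 16 (ℕ.*-monoˡ-≤ (y ℕ.* (k ℕ.* a)) p₄) ⟩
    16 ℕ.* (7 ℕ.* W ℕ.* (y ℕ.* (k ℕ.* a)))        ≡⟨ solve 2 (λ W z → con 16 :* (con 7 :* W :* z) := con 7 :* (con 16 :* (W :* z))) refl W (y ℕ.* (k ℕ.* a)) ⟩
    7 ℕ.* (16 ℕ.* (W ℕ.* (y ℕ.* (k ℕ.* a))))      ∎)))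
  where open ℕ.≤-Reasoning

-- With w² in the role of ln n and M in that of n ^ s, this says up to
-- constants that κ is below 3 √ (ln n) n ^ ((3 - s) / 2).
TooSmall : (n w M κ : ℕ) → Set
TooSmall n w M κ = 5 ℕ.* (suc κ ℕ.* suc κ ℕ.* suc M) ℕ.≤ 16 ℕ.* (w ℕ.* w ℕ.* n ℕ.^ 3)

-- The last clause is the interface to the real threshold: for a set of size κ above it, only ¬
-- `TooSmall` remains to be shown.
Parameters : (n w M : ℕ) → Set
Parameters n w M = ∃[ k ] ∃[ m ] 0 ℕ.< n C 3 × k ℕ.≤ n × m ℕ.≤ M ×
  (n C k) ℕ.* (n C 3 ℕ.∸ k C 3) ℕ.^ m ℕ.< (n C 3) ℕ.^ m ×
  (∀ κ → ¬ TooSmall n w M κ → k ℕ.≤ κ)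

tooSmall? : ∀ n w M → Decidable (TooSmall n w M)
tooSmall? n w M κ = 5 ℕ.* (suc κ ℕ.* suc κ ℕ.* suc M) ℕ.≤? 16 ℕ.* (w ℕ.* w ℕ.* n ℕ.^ 3)

tooSmall-mono : ∀ {n w M κ κ′} → κ ℕ.≤ κ′ → TooSmall n w M κ′ → TooSmall n w M κ
tooSmall-mono {M = M} le = ℕ.≤-trans
  (ℕ.*-monoʳ-≤ 5 (ℕ.*-monoˡ-≤ (suc M) (ℕ.*-mono-≤ (s≤s le) (s≤s le))))

module _ (n w M : ℕ) (26≤w : 26 ℕ.≤ w) (lo : 2 ℕ.^ (2 ℕ.* (w ℕ.* w)) ℕ.< n)
  (hi : n ℕ.≤ 2 ℕ.^ (2 ℕ.* (suc w ℕ.* suc w))) (n²≤M : n ℕ.^ 2 ℕ.≤ M) (M≤n³ : M ℕ.≤ n ℕ.^ 3) where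

  open ℕ.≤-Reasoning

  private
    v = suc (2 ℕ.* (suc w ℕ.* suc w))

    instance
      _ : NonZero n
      _ = ℕ.>-nonZero (ℕ.≤-<-trans z≤n lo)
      _ : NonZero (w ℕ.* w)
      _ = ℕ.m*n≢0 w w {{ℕ.>-nonZero (ℕ.≤-trans (s≤s z≤n) 26≤w)}} {{ℕ.>-nonZero (ℕ.≤-trans (s≤s z≤n) 26≤w)}}

    676≤w² : 676 ℕ.≤ w ℕ.* w
    676≤w² = ℕ.*-mono-≤ 26≤w 26≤w

    n<2^v : n ℕ.< 2 ℕ.^ v
    n<2^v = ℕ.≤-<-trans hi (ℕ.^-monoʳ-< 2 (s≤s (s≤s z≤n)) (ℕ.n<1+n (2 ℕ.* (suc w ℕ.* suc w))))

    3v≤7w² : 3 ℕ.* v ℕ.≤ 7 ℕ.* (w ℕ.* w)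
    3v≤7w² = subst (λ w → 3 ℕ.* suc (2 ℕ.* (suc w ℕ.* suc w)) ℕ.≤ 7 ℕ.* (w ℕ.* w)) (ℕ.m∸n+n≡m 26≤w)
      (ℕ.≤-trans (ℕ.m≤m+n _ (x ℕ.* x ℕ.+ 40 ℕ.* x ℕ.+ 355)) (ℕ.≤-reflexive
        (solve 1 (λ x → con 3 :* (con 1 :+ con 2 :* ((con 1 :+ (x :+ con 26)) :* (con 1 :+ (x :+ con 26)))) :+ (x :* x :+ con 40 :* x :+ con 355)
          := con 7 :* ((x :+ con 26) :* (x :+ con 26))) refl x)))
      where x = w ℕ.∸ 26

    -- v is of logarithmic order. The factor 8 limits the rounding loss of M / (v k) to one eighth,
    -- and 2 w² ≤ v turns the bound into 16 w² ≤ n.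
    8v≤n : 8 ℕ.* v ℕ.≤ n
    8v≤n = begin
      8 ℕ.* v                            ≤⟨ ℕ.m≤m+n (8 ℕ.* v) v ⟩
      8 ℕ.* v ℕ.+ v                      ≡⟨ solve 1 (λ v → con 8 :* v :+ v := con 3 :* (con 3 :* v)) refl v ⟩
      3 ℕ.* (3 ℕ.* v)                    ≤⟨ ℕ.*-monoʳ-≤ 3 3v≤7w² ⟩
      3 ℕ.* (7 ℕ.* (w ℕ.* w))            ≡⟨ ℕ.*-assoc 3 7 (w ℕ.* w) ⟨
      21 ℕ.* (w ℕ.* w)                   ≤⟨ ℕ.*-monoˡ-≤ (w ℕ.* w) (ℕ.≤-trans (ℕ.m≤m+n 21 655) 676≤w²) ⟩
      w ℕ.* w ℕ.* (w ℕ.* w)              ≤⟨ n²≤4^n (w ℕ.* w) ⟩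
      4 ℕ.^ (w ℕ.* w)                    ≡⟨ ℕ.^-*-assoc 2 2 (w ℕ.* w) ⟩
      2 ℕ.^ (2 ℕ.* (w ℕ.* w))            ≤⟨ ℕ.<⇒≤ lo ⟩
      n                                  ∎

    31≤n : 31 ℕ.≤ n
    31≤n = begin
      31                   ≤⟨ ℕ.m≤m+n 31 1425 ⟩
      2 ℕ.* (27 ℕ.* 27) ℕ.∸ 2   ≤⟨ ℕ.m∸n≤m (2 ℕ.* (27 ℕ.* 27)) 2 ⟩
      2 ℕ.* (27 ℕ.* 27)    ≤⟨ ℕ.*-monoʳ-≤ 2 (ℕ.*-mono-≤ (s≤s 26≤w) (s≤s 26≤w)) ⟩
      2 ℕ.* (suc w ℕ.* suc w)    ≤⟨ ℕ.n≤1+n _ ⟩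
      v                    ≤⟨ ℕ.m≤n*m v 8 ⟩
      8 ℕ.* v              ≤⟨ 8v≤n ⟩
      n                    ∎

    -- The origin of 26: 5 * 32² * 2 = 16 * 640, and 26 is the least w with w² ≥ 640.
    tooSmall-31 : TooSmall n w M 31
    tooSmall-31 = begin
      5 ℕ.* (1024 ℕ.* suc M)             ≤⟨ ℕ.*-monoʳ-≤ 5 (ℕ.*-monoʳ-≤ 1024 (ℕ.+-mono-≤ (ℕ.m^n>0 n 3) M≤n³)) ⟩
      5 ℕ.* (1024 ℕ.* (x ℕ.+ x))         ≡⟨ cong (λ y → 5 ℕ.* (1024 ℕ.* (x ℕ.+ y))) (ℕ.+-identityʳ x) ⟨
      5 ℕ.* (1024 ℕ.* (2 ℕ.* x))         ≡⟨ cong (5 ℕ.*_) (ℕ.*-assoc 1024 2 x) ⟨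
      5 ℕ.* (2048 ℕ.* x)                 ≡⟨ ℕ.*-assoc 5 2048 x ⟨
      10240 ℕ.* x                        ≡⟨ ℕ.*-assoc 16 640 x ⟩
      16 ℕ.* (640 ℕ.* x)                 ≤⟨ ℕ.*-monoʳ-≤ 16 (ℕ.*-monoˡ-≤ x (ℕ.≤-trans (ℕ.m≤m+n 640 36) 676≤w²)) ⟩
      16 ℕ.* (w ℕ.* w ℕ.* x)             ∎
      where x = n ℕ.^ 3

    -- As 16 w² ≤ n, the right side is at most n⁴, and M ≥ n² puts the left side above that. So the
    -- search for k ends by n.
    ¬tooSmall-n : ¬ TooSmall n w M n
    ¬tooSmall-n = ℕ.<⇒≱ (begin-strict
      16 ℕ.* (w ℕ.* w ℕ.* n ℕ.^ 3)       ≡⟨ ℕ.*-assoc 16 (w ℕ.* w) _ ⟨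
      16 ℕ.* (w ℕ.* w) ℕ.* n ℕ.^ 3       ≤⟨ ℕ.*-monoˡ-≤ (n ℕ.^ 3) 16w²≤n ⟩
      n ℕ.* n ℕ.^ 3                      ≡⟨ solve 1 (λ n → n :* (n :* (n :* (n :* con 1))) := n :* n :* (n :* (n :* con 1))) refl n ⟩
      n ℕ.* n ℕ.* n ℕ.^ 2                ≤⟨ ℕ.*-mono-≤ (ℕ.*-mono-≤ (ℕ.n≤1+n n) (ℕ.n≤1+n n)) n²≤M ⟩
      suc n ℕ.* suc n ℕ.* M              <⟨ ℕ.*-monoʳ-< (suc n ℕ.* suc n) (ℕ.n<1+n M) ⟩
      suc n ℕ.* suc n ℕ.* suc M          ≤⟨ ℕ.m≤n*m _ 5 ⟩
      5 ℕ.* (suc n ℕ.* suc n ℕ.* suc M)  ∎)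
      where
      16w²≤n : 16 ℕ.* (w ℕ.* w) ℕ.≤ n
      16w²≤n = begin
        16 ℕ.* (w ℕ.* w)            ≡⟨ ℕ.*-assoc 8 2 (w ℕ.* w) ⟩
        8 ℕ.* (2 ℕ.* (w ℕ.* w))     ≤⟨ ℕ.*-monoʳ-≤ 8 (ℕ.≤-trans (ℕ.*-monoʳ-≤ 2 (ℕ.*-mono-≤ (ℕ.n≤1+n w) (ℕ.n≤1+n w))) (ℕ.n≤1+n _)) ⟩
        8 ℕ.* v                     ≤⟨ 8v≤n ⟩
        n                           ∎

    -- The hypothesis of `decay`: y = M / (v k) steps halve the family, and v k such rounds fit into
    -- M steps. Writing k as h + 2 matches the product formula for `k C 3`.
    enough-steps : ∀ {h} → 30 ℕ.≤ h → suc (suc h) ℕ.≤ n → ¬ TooSmall n w M (suc (suc h)) →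
      let k = suc (suc h) in n C 3 ℕ.≤ M / (v ℕ.* k) ℕ.* (k C 3)
    enough-steps {h} 30≤h k≤n large = ℕ.*-cancelˡ-≤ 6 (begin
      6 ℕ.* (n C 3)                    ≤⟨ 6*nC3≤n³ n ⟩
      n ℕ.^ 3                          ≤⟨ rescale {W = w ℕ.* w} {n ℕ.^ 3} {suc M} {suc k ℕ.* suc k} {suc h ℕ.* h} {v} {k} {y}
                                             (ℕ.<⇒≤ (ℕ.≰⇒> large)) square quotient 3v≤7w² ⟩
      y ℕ.* (k ℕ.* (suc h ℕ.* h))      ≡⟨ cong (y ℕ.*_) (6*[2+n]C3 h) ⟨
      y ℕ.* (6 ℕ.* (k C 3))            ≡⟨ solve 2 (λ y c → y :* (con 6 :* c) := con 6 :* (y :* c)) refl y (k C 3) ⟩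
      6 ℕ.* (y ℕ.* (k C 3))            ∎)
      where
      k = suc (suc h)
      y = M / (v ℕ.* k)

      square : 5 ℕ.* (suc k ℕ.* suc k) ℕ.≤ 6 ℕ.* (suc h ℕ.* h)
      square = subst (λ h → 5 ℕ.* ((3 ℕ.+ h) ℕ.* (3 ℕ.+ h)) ℕ.≤ 6 ℕ.* (suc h ℕ.* h)) (ℕ.m∸n+n≡m 30≤h)
        (ℕ.≤-trans (ℕ.m≤m+n _ (x ℕ.* x ℕ.+ 36 ℕ.* x ℕ.+ 135)) (ℕ.≤-reflexive
          (solve 1 (λ x → con 5 :* ((con 3 :+ (x :+ con 30)) :* (con 3 :+ (x :+ con 30))) :+ (x :* x :+ con 36 :* x :+ con 135)
            := con 6 :* ((con 1 :+ (x :+ con 30)) :* (x :+ con 30))) refl x)))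
        where x = h ℕ.∸ 30

      8vk≤M : 8 ℕ.* (v ℕ.* k) ℕ.≤ suc M
      8vk≤M = begin
        8 ℕ.* (v ℕ.* k)     ≡⟨ ℕ.*-assoc 8 v k ⟨
        8 ℕ.* v ℕ.* k       ≤⟨ ℕ.*-mono-≤ 8v≤n k≤n ⟩
        n ℕ.* n             ≡⟨ cong (n ℕ.*_) (ℕ.*-identityʳ n) ⟨
        n ℕ.^ 2             ≤⟨ n²≤M ⟩
        M                   ≤⟨ ℕ.n≤1+n M ⟩
        suc M               ∎

      -- M + 1 is at most (y + 1) v k. Of its eightfold, the part 8 v k due to rounding is at most M
      -- + 1.
      quotient : 7 ℕ.* suc M ℕ.≤ 8 ℕ.* (y ℕ.* (v ℕ.* k))
      quotient = ℕ.+-cancelˡ-≤ (suc M) _ _ (begin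
        suc M ℕ.+ 7 ℕ.* suc M
          ≤⟨ ℕ.*-monoʳ-≤ 8 (ℕ.≤-trans (s≤s (ℕ.≤-reflexive (m≡m%n+[m/n]*n M (v ℕ.* k))))
               (ℕ.+-monoˡ-≤ (y ℕ.* (v ℕ.* k)) (m%n<n M (v ℕ.* k)))) ⟩
        8 ℕ.* (v ℕ.* k ℕ.+ y ℕ.* (v ℕ.* k))
          ≡⟨ ℕ.*-distribˡ-+ 8 (v ℕ.* k) _ ⟩
        8 ℕ.* (v ℕ.* k) ℕ.+ 8 ℕ.* (y ℕ.* (v ℕ.* k))
          ≤⟨ ℕ.+-monoˡ-≤ _ 8vk≤M ⟩
        suc M ℕ.+ 8 ℕ.* (y ℕ.* (v ℕ.* k)) ∎)

  private
    choose : ∀ h → 30 ℕ.≤ h → suc (suc h) ℕ.≤ n →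
      TooSmall n w M (suc h) → ¬ TooSmall n w M (suc (suc h)) → Parameters n w M
    choose h 30≤h k≤n small large = k , m , 0<C , k≤n , m/n*n≤m M (v ℕ.* k) , decayed , minimal
      where
      k = suc (suc h)
      -- Rounding M down to a multiple of v k lets `decay` group the steps into v k blocks of equal
      -- length.
      m = M / (v ℕ.* k) ℕ.* (v ℕ.* k)

      0<C : 0 ℕ.< n C 3
      0<C = C-monoˡ-≤ {3} 3 (ℕ.≤-trans (ℕ.m≤m+n 3 28) 31≤n)

      decayed : (n C k) ℕ.* (n C 3 ℕ.∸ k C 3) ℕ.^ m ℕ.< (n C 3) ℕ.^ m
      decayed = decay {e = v ℕ.* k} (M / (v ℕ.* k)) 0<C (C-monoˡ-≤ 3 k≤n)
        (enough-steps 30≤h k≤n large) (nCk<2^ {n} {v} n<2^v k)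

      minimal : ∀ κ → ¬ TooSmall n w M κ → k ℕ.≤ κ
      minimal κ ¬small = ℕ.≰⇒> (λ κ≤ → ¬small (tooSmall-mono {n} {w} {M} {κ} {suc h} κ≤ small))

    last-tooSmall : ∃[ m ] 31 ℕ.≤ m × m ℕ.< n × TooSmall n w M m × ¬ TooSmall n w M (suc m)
    last-tooSmall = subst (λ x → ∃[ m ] 31 ℕ.≤ m × m ℕ.< x × TooSmall n w M m × ¬ TooSmall n w M (suc m)) n-31+31
      (crossing (tooSmall? n w M) 31 (n ℕ.∸ 31) tooSmall-31 (λ small → ¬tooSmall-n (subst (TooSmall n w M) n-31+31 small)))
      where
      n-31+31 = ℕ.m∸n+n≡m 31≤n

    from-last : ∃[ m ] (31 ℕ.≤ m × m ℕ.< n × TooSmall n w M m × ¬ TooSmall n w M (suc m)) → Parameters n w M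
    from-last (suc h , s≤s 30≤h , k≤n , small , large) = choose h 30≤h k≤n small large

  parameters : Parameters n w M
  parameters = from-last last-tooSmall

-- (x / 2 w) ^ 2 D < n ^ (3 D - (a + 2)) without division.
power-bound : ∀ x n w m a D → n ℕ.^ a ℕ.< m ℕ.^ D → 4 ℕ.^ D ℕ.* n ℕ.^ 2 ℕ.≤ 5 ℕ.^ D →
  .{{_ : NonZero x}} → 5 ℕ.* (x ℕ.* x ℕ.* m) ℕ.≤ 16 ℕ.* (w ℕ.* w ℕ.* n ℕ.^ 3) →
  x ℕ.^ (2 ℕ.* D) ℕ.* n ℕ.^ suc (suc a) ℕ.< n ℕ.^ (3 ℕ.* D) ℕ.* (2 ℕ.* w) ℕ.^ (2 ℕ.* D)
power-bound x n w m a D n^a<m^D 4^Dn²≤5^D small = ℕ.*-cancelˡ-< (4 ℕ.^ D) _ _ (begin-strict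
  4 ℕ.^ D ℕ.* (x ℕ.^ (2 ℕ.* D) ℕ.* n ℕ.^ suc (suc a))
    ≡⟨ solve 4 (λ f x n z → f :* (x :* (n :* (n :* z))) := x :* z :* (f :* (n :* (n :* con 1)))) refl
         (4 ℕ.^ D) (x ℕ.^ (2 ℕ.* D)) n (n ℕ.^ a) ⟩
  x ℕ.^ (2 ℕ.* D) ℕ.* n ℕ.^ a ℕ.* (4 ℕ.^ D ℕ.* n ℕ.^ 2)
    ≤⟨ ℕ.*-monoʳ-≤ (x ℕ.^ (2 ℕ.* D) ℕ.* n ℕ.^ a) 4^Dn²≤5^D ⟩
  x ℕ.^ (2 ℕ.* D) ℕ.* n ℕ.^ a ℕ.* 5 ℕ.^ D
    <⟨ ℕ.*-monoˡ-< (5 ℕ.^ D) (ℕ.*-monoʳ-< (x ℕ.^ (2 ℕ.* D)) n^a<m^D) ⟩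
  x ℕ.^ (2 ℕ.* D) ℕ.* m ℕ.^ D ℕ.* 5 ℕ.^ D
    ≡⟨ solve 3 (λ x m f → x :* m :* f := f :* (x :* m)) refl (x ℕ.^ (2 ℕ.* D)) (m ℕ.^ D) (5 ℕ.^ D) ⟩
  5 ℕ.^ D ℕ.* (x ℕ.^ (2 ℕ.* D) ℕ.* m ℕ.^ D)
    ≡⟨ cong (λ z → 5 ℕ.^ D ℕ.* (z ℕ.* m ℕ.^ D)) (square x) ⟩
  5 ℕ.^ D ℕ.* ((x ℕ.* x) ℕ.^ D ℕ.* m ℕ.^ D)
    ≡⟨ cong (5 ℕ.^ D ℕ.*_) (^-distribʳ-* D (x ℕ.* x) m) ⟨
  5 ℕ.^ D ℕ.* (x ℕ.* x ℕ.* m) ℕ.^ D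
    ≡⟨ ^-distribʳ-* D 5 (x ℕ.* x ℕ.* m) ⟨
  (5 ℕ.* (x ℕ.* x ℕ.* m)) ℕ.^ D
    ≤⟨ ℕ.^-monoˡ-≤ D small ⟩
  (16 ℕ.* (w ℕ.* w ℕ.* n ℕ.^ 3)) ℕ.^ D
    -- 16 w² = 4 (2 w)²: the 4 cancels against the cost 5 / 4 of enclosing s, and 2 w is the
    -- denominator of x / 2 w.
    ≡⟨ cong (ℕ._^ D) (solve 2 (λ w z → con 16 :* (w :* w :* z) := con 4 :* (z :* (con 2 :* w :* (con 2 :* w)))) refl w (n ℕ.^ 3)) ⟩
  (4 ℕ.* (n ℕ.^ 3 ℕ.* (2 ℕ.* w ℕ.* (2 ℕ.* w)))) ℕ.^ D
    ≡⟨ ^-distribʳ-* D 4 _ ⟩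
  4 ℕ.^ D ℕ.* (n ℕ.^ 3 ℕ.* (2 ℕ.* w ℕ.* (2 ℕ.* w))) ℕ.^ D
    ≡⟨ cong (4 ℕ.^ D ℕ.*_) (^-distribʳ-* D (n ℕ.^ 3) _) ⟩
  4 ℕ.^ D ℕ.* ((n ℕ.^ 3) ℕ.^ D ℕ.* (2 ℕ.* w ℕ.* (2 ℕ.* w)) ℕ.^ D)
    ≡⟨ cong₂ (λ y z → 4 ℕ.^ D ℕ.* (y ℕ.* z)) (ℕ.^-*-assoc n 3 D) (sym (square (2 ℕ.* w))) ⟩
  4 ℕ.^ D ℕ.* (n ℕ.^ (3 ℕ.* D) ℕ.* (2 ℕ.* w) ℕ.^ (2 ℕ.* D)) ∎)
  where
  open ℕ.≤-Reasoning

  instance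
    _ = ℕ.m^n≢0 x (2 ℕ.* D)
    _ = ℕ.m^n≢0 5 D

  square : ∀ x → x ℕ.^ (2 ℕ.* D) ≡ (x ℕ.* x) ℕ.^ D
  square x = trans (sym (ℕ.^-*-assoc x 2 D)) (cong (λ z → (x ℕ.* z) ℕ.^ D) (ℕ.*-identityʳ x))

-- Natural numbers inside the rationals.

fromℚᵘ-homo-* : ∀ p q → fromℚᵘ (p ℚᵘ.* q) ≡ fromℚᵘ p ℚ.* fromℚᵘ q
fromℚᵘ-homo-* p q = ℚ.toℚᵘ-injective (ℚᵘ.≃-trans (ℚ.toℚᵘ-fromℚᵘ (p ℚᵘ.* q)) (ℚᵘ.≃-sym
  (ℚᵘ.≃-trans (ℚ.toℚᵘ-homo-* (fromℚᵘ p) (fromℚᵘ q)) (ℚᵘ.*-cong (ℚ.toℚᵘ-fromℚᵘ p) (ℚ.toℚᵘ-fromℚᵘ q)))))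

fromℚᵘ-homo-+ : ∀ p q → fromℚᵘ (p ℚᵘ.+ q) ≡ fromℚᵘ p ℚ.+ fromℚᵘ q
fromℚᵘ-homo-+ p q = ℚ.toℚᵘ-injective (ℚᵘ.≃-trans (ℚ.toℚᵘ-fromℚᵘ (p ℚᵘ.+ q)) (ℚᵘ.≃-sym
  (ℚᵘ.≃-trans (ℚ.toℚᵘ-homo-+ (fromℚᵘ p) (fromℚᵘ q)) (ℚᵘ.+-cong (ℚ.toℚᵘ-fromℚᵘ p) (ℚ.toℚᵘ-fromℚᵘ q)))))

fromℚᵘ-homo‿- : ∀ p → fromℚᵘ (ℚᵘ.- p) ≡ ℚ.- fromℚᵘ p
fromℚᵘ-homo‿- p = ℚ.toℚᵘ-injective (ℚᵘ.≃-trans (ℚ.toℚᵘ-fromℚᵘ (ℚᵘ.- p)) (ℚᵘ.≃-sym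
  (ℚᵘ.≃-trans (ℚ.toℚᵘ-homo‿- (fromℚᵘ p)) (ℚᵘ.-‿cong (ℚ.toℚᵘ-fromℚᵘ p)))))

fromℚᵘ-mono-< : ∀ {p q} → p ℚᵘ.< q → fromℚᵘ p ℚ.< fromℚᵘ q
fromℚᵘ-mono-< {p} {q} p<q = ℚ.toℚᵘ-cancel-< (ℚᵘ.<-respˡ-≃ (ℚᵘ.≃-sym (ℚ.toℚᵘ-fromℚᵘ p))
  (ℚᵘ.<-respʳ-≃ (ℚᵘ.≃-sym (ℚ.toℚᵘ-fromℚᵘ q)) p<q))

/-mono-< : ∀ {m n} k → m ℕ.< n → + m ℚ./ suc k ℚ.< + n ℚ./ suc k
/-mono-< {m} {n} k m<n = fromℚᵘ-mono-< {mkℚᵘ (+ m) k} {mkℚᵘ (+ n) k} (*<* (ℤ.*-monoʳ-<-pos (+ suc k) (ℤ.+<+ m<n)))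

-- Opaque because unfolding _/_ exposes a gcd computation on open terms.
opaque

  ι : ℕ → ℚ
  ι n = + n ℚ./ 1

  ι-def : ∀ n → ι n ≡ + n ℚ./ 1
  ι-def n = refl

  ι-* : ∀ m n → ι (m ℕ.* n) ≡ ι m ℚ.* ι n
  ι-* m n = trans (cong (λ i → fromℚᵘ (mkℚᵘ i 0)) (ℤ.pos-* m n)) (fromℚᵘ-homo-* (mkℚᵘ (+ m) 0) (mkℚᵘ (+ n) 0))

  ι-difference : ∀ m n → (+ m ℤ.- + n) ℚ./ 1 ≡ ι m ℚ.- ι n
  ι-difference m n = trans (ℚ.fromℚᵘ-cong {mkℚᵘ (+ m ℤ.- + n) 0} {mkℚᵘ (+ m) 0 ℚᵘ.- mkℚᵘ (+ n) 0}
      (*≡* (cong (ℤ._* + 1) (cong₂ ℤ._+_ (sym (ℤ.*-identityʳ (+ m))) (sym (ℤ.*-identityʳ (ℤ.- + n)))))))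
    (trans (fromℚᵘ-homo-+ (mkℚᵘ (+ m) 0) (ℚᵘ.- mkℚᵘ (+ n) 0)) (cong (+ m ℚ./ 1 ℚ.+_) (fromℚᵘ-homo‿- (mkℚᵘ (+ n) 0))))

  /-*-cancel : ∀ i k → i ℚ./ suc k ℚ.* ι (suc k) ≡ i ℚ./ 1
  /-*-cancel i k = trans (sym (fromℚᵘ-homo-* (mkℚᵘ i k) (mkℚᵘ (+ suc k) 0)))
    (ℚ.fromℚᵘ-cong {mkℚᵘ i k ℚᵘ.* mkℚᵘ (+ suc k) 0} {mkℚᵘ i 0}
      (*≡* (trans (ℤ.*-identityʳ _) (cong (λ d → i ℤ.* + d) (sym (ℕ.*-identityʳ (suc k)))))))

  ι-mono-< : ∀ {m n} → m ℕ.< n → ι m ℚ.< ι n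
  ι-mono-< {m} {n} = /-mono-< {m} {n} 0

ι-^ : ∀ m k → ι (m ℕ.^ k) ≡ ι m ^ℚ k
ι-^ m zero    = ι-def 1
ι-^ m (suc k) = trans (ι-* m (m ℕ.^ k)) (cong (ι m ℚ.*_) (ι-^ m k))

ι-mono-≤ : ∀ {m n} → m ℕ.≤ n → ι m ℚ.≤ ι n
ι-mono-≤ m≤n with ℕ.m≤n⇒m<n∨m≡n m≤n
... | inj₁ m<n  = ℚ.<⇒≤ (ι-mono-< m<n)
... | inj₂ refl = ℚ.≤-refl

ι-pos : ∀ {n} → 0 ℕ.< n → 0ℚ ℚ.< ι n
ι-pos {n} 0<n = subst (ℚ._< ι n) (ι-def 0) (ι-mono-< 0<n)

2ℚ 3ℚ 4ℚ 5/2 : ℚ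
2ℚ  = + 2 ℚ./ 1
3ℚ  = + 3 ℚ./ 1
4ℚ  = + 4 ℚ./ 1
5/2 = + 5 ℚ./ 2

ι-2* : ∀ n → ι (2 ℕ.* n) ≡ 2ℚ ℚ.* ι n
ι-2* n = trans (ι-* 2 n) (cong (ℚ._* ι n) (ι-def 2))

0<½ : 0ℚ ℚ.< ½
0<½ = from-yes (0ℚ ℚ.<? ½)

*-monoˡ-< : ∀ {p q r} → 0ℚ ℚ.< r → p ℚ.< q → p ℚ.* r ℚ.< q ℚ.* r
*-monoˡ-< {r = r} 0<r p<q = ℚ.*-monoˡ-<-pos r {{ℚ.positive 0<r}} p<q

*-mono-≤ : ∀ {p q r s} → 0ℚ ℚ.≤ q → 0ℚ ℚ.≤ r → p ℚ.≤ q → r ℚ.≤ s → p ℚ.* r ℚ.≤ q ℚ.* s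
*-mono-≤ {q = q} {r} 0≤q 0≤r p≤q r≤s = ℚ.≤-trans
  (ℚ.*-monoʳ-≤-nonNeg r {{ℚ.nonNegative 0≤r}} p≤q)
  (ℚ.*-monoˡ-≤-nonNeg q {{ℚ.nonNegative 0≤q}} r≤s)

*-pos : ∀ {p q} → 0ℚ ℚ.< p → 0ℚ ℚ.< q → 0ℚ ℚ.< p ℚ.* q
*-pos {p} {q} 0<p 0<q = subst (ℚ._< p ℚ.* q) (ℚ.*-zeroˡ q) (*-monoˡ-< 0<q 0<p)

^ℚ-pos : ∀ {p} → 0ℚ ℚ.< p → ∀ k → 0ℚ ℚ.< p ^ℚ k
^ℚ-pos 0<p zero    = ℚ.positive⁻¹ 1ℚ
^ℚ-pos 0<p (suc k) = *-pos 0<p (^ℚ-pos 0<p k)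

^ℚ-monoˡ-≤ : ∀ {p q} → 0ℚ ℚ.< p → p ℚ.≤ q → ∀ k → p ^ℚ k ℚ.≤ q ^ℚ k
^ℚ-monoˡ-≤ 0<p p≤q zero    = ℚ.≤-refl
^ℚ-monoˡ-≤ 0<p p≤q (suc k) = *-mono-≤ (ℚ.≤-trans (ℚ.<⇒≤ 0<p) p≤q) (ℚ.<⇒≤ (^ℚ-pos 0<p k))
  p≤q (^ℚ-monoˡ-≤ 0<p p≤q k)

^ℚ-monoˡ-< : ∀ {p q} → 0ℚ ℚ.< p → p ℚ.< q → ∀ k → p ^ℚ suc k ℚ.< q ^ℚ suc k
^ℚ-monoˡ-< {p} {q} 0<p p<q k = ℚ.<-≤-trans (*-monoˡ-< (^ℚ-pos 0<p k) p<q)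
  (ℚ.*-monoˡ-≤-nonNeg q {{ℚ.nonNegative (ℚ.<⇒≤ (ℚ.<-trans 0<p p<q))}} (^ℚ-monoˡ-≤ 0<p (ℚ.<⇒≤ p<q) k))

0≤ι : ∀ {n} → 0ℚ ℚ.≤ ι n
0≤ι {n} = subst (ℚ._≤ ι n) (ι-def 0) (ι-mono-≤ z≤n)

½^k*2^k≡1 : ∀ k → ι (2 ℕ.^ k) ℚ.* ½ ^ℚ k ≡ 1ℚ
½^k*2^k≡1 zero    = cong (ℚ._* 1ℚ) (ι-def 1)
½^k*2^k≡1 (suc k) = trans (cong (ℚ._* (½ ℚ.* ½ ^ℚ k)) (ι-2* (2 ℕ.^ k)))
  (trans (solveℚ 2 (λ x y → conℚ 2ℚ ⊗ x ⊗ (conℚ ½ ⊗ y) ⩦ x ⊗ y) refl (ι (2 ℕ.^ k)) (½ ^ℚ k)) (½^k*2^k≡1 k))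

-- The two sides are equal; the left one has the shape (i - j) / (1 + k) in which `_^_` takes its
-- exponents.
exponent-bound : ∀ a d k → suc k ≡ 2 ℕ.* suc d →
  (+ (3 ℕ.* suc d) ℤ.- + a) ℚ./ suc k ℚ.≤ (3ℚ ℚ.- + a ℚ./ suc d) ℚ.* ½
exponent-bound a d k k+1≡2D = ℚ.*-cancelʳ-≤-pos (ι (suc k)) {{ℚ.positive (ι-pos (s≤s z≤n))}} (ℚ.≤-reflexive (begin
  (+ (3 ℕ.* D) ℤ.- + a) ℚ./ suc k ℚ.* ι (suc k)
    ≡⟨ /-*-cancel (+ (3 ℕ.* D) ℤ.- + a) k ⟩
  (+ (3 ℕ.* D) ℤ.- + a) ℚ./ 1
    ≡⟨ ι-difference (3 ℕ.* D) a ⟩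
  ι (3 ℕ.* D) ℚ.- ι a
    ≡⟨ cong₂ ℚ._-_ (trans (ι-* 3 D) (cong (ℚ._* ι D) (ι-def 3))) (trans (ι-def a) (sym (/-*-cancel (+ a) d))) ⟩
  3ℚ ℚ.* ι D ℚ.- r ℚ.* ι D
    ≡⟨ solveℚ 2 (λ r D → conℚ 3ℚ ⊗ D ⊖ r ⊗ D ⩦ (conℚ 3ℚ ⊖ r) ⊗ conℚ ½ ⊗ (conℚ 2ℚ ⊗ D)) refl r (ι D) ⟩
  (3ℚ ℚ.- r) ℚ.* ½ ℚ.* (2ℚ ℚ.* ι D)
    ≡⟨ cong ((3ℚ ℚ.- r) ℚ.* ½ ℚ.*_) (trans (cong ι k+1≡2D) (ι-2* D)) ⟨
  (3ℚ ℚ.- r) ℚ.* ½ ℚ.* ι (suc k) ∎))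
  where
  open ≡-Reasoning
  D = suc d
  r = + a ℚ./ suc d

-- Bounds for products, logarithms and powers of cuts.

module _ {x y : Cut} {a b c d : ℚ} (La : L x a) (Ub : U x b) (Lc : L y c) (Ud : U y d)
  (0≤a : 0ℚ ℚ.≤ a) (a≤b : a ℚ.≤ b) (0≤c : 0ℚ ℚ.≤ c) (c≤d : c ℚ.≤ d) where

  private
    0≤b = ℚ.≤-trans 0≤a a≤b
    ac≤ad = *-mono-≤ 0≤a 0≤c ℚ.≤-refl c≤d
    ac≤bc = *-mono-≤ 0≤b 0≤c a≤b ℚ.≤-refl
    ad≤bd = *-mono-≤ 0≤b (ℚ.≤-trans 0≤c c≤d) a≤b ℚ.≤-refl
    bc≤bd = *-mono-≤ 0≤b 0≤c ℚ.≤-refl c≤d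

  -- For nonnegative brackets a c is the least of the four products and b d the greatest, so one
  -- comparison implies all four.
  *-L : ∀ {q} → q ℚ.< a ℚ.* c → L (x * y) q
  *-L q<ac = a , b , c , d , La , Ub , Lc , Ud , q<ac , ℚ.<-≤-trans q<ac ac≤ad ,
    ℚ.<-≤-trans q<ac ac≤bc , ℚ.<-≤-trans q<ac (ℚ.≤-trans ac≤bc bc≤bd)

  *-U : ∀ {q} → b ℚ.* d ℚ.< q → U (x * y) q
  *-U bd<q = a , b , c , d , La , Ub , Lc , Ud , ℚ.≤-<-trans (ℚ.≤-trans ac≤bc bc≤bd) bd<q ,
    ℚ.≤-<-trans ad≤bd bd<q , ℚ.≤-<-trans bc≤bd bd<q , bd<q

fromℕ-L : ∀ {n q} → q ℚ.< ι n → L (fromℕ n) q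
fromℕ-L {n} = subst (_ ℚ.<_) (ι-def n)

-- For t = 1 - A / (2 A) = ½ the definition of exp gives exp A ≤ 4 ^ A.
exp-U : ∀ {A a k r} → suc k ≡ 2 ℕ.* A → a ≡ ι A → ι (2 ℕ.^ suc k) ℚ.< r → U (exp a) r
exp-U {A} {a} {k} {r} k+1≡2A a≡ιA 2^k+1<r = k , subst (0ℚ ℚ.<_) (sym t≡½) 0<½ ,
  subst (λ t → 1ℚ ℚ.< r ℚ.* t ^ℚ suc k) (sym t≡½)
    (subst (ℚ._< r ℚ.* ½ ^ℚ suc k) (½^k*2^k≡1 (suc k)) (*-monoˡ-< (^ℚ-pos 0<½ (suc k)) 2^k+1<r))
  where
  h = + 1 ℚ./ suc k

  t≡½ : 1ℚ ℚ.- a ℚ.* h ≡ ½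
  t≡½ = begin
    1ℚ ℚ.- a ℚ.* h
      ≡⟨ solveℚ 2 (λ a h → conℚ 1ℚ ⊖ a ⊗ h ⩦ conℚ 1ℚ ⊖ conℚ ½ ⊗ (h ⊗ (conℚ 2ℚ ⊗ a))) refl a h ⟩
    1ℚ ℚ.- ½ ℚ.* (h ℚ.* (2ℚ ℚ.* a))
      ≡⟨ cong (λ z → 1ℚ ℚ.- ½ ℚ.* (h ℚ.* z)) (trans (cong (2ℚ ℚ.*_) a≡ιA) (trans (sym (ι-2* A)) (cong ι (sym k+1≡2A)))) ⟩
    1ℚ ℚ.- ½ ℚ.* (h ℚ.* ι (suc k))
      ≡⟨ cong (λ z → 1ℚ ℚ.- ½ ℚ.* z) (/-*-cancel (+ 1) k) ⟩
    ½ ∎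
    where open ≡-Reasoning

-- exp (w²) ≤ 4 ^ (w²) < n, and a rational inside the last gap witnesses the strict inequality of
-- cuts.
√ln-L : ∀ {n} w → 0 ℕ.< w → 2 ℕ.^ (2 ℕ.* (w ℕ.* w)) ℕ.< n → L (√ (ln (fromℕ n))) (ι w)
√ln-L {n} w 0<w lt = let r , 2^e<r , r<n = ℚ.<-dense (ι-mono-< lt) in
  inj₂ (r , exp-U {w ℕ.* w} suc-k≡ (sym (ι-* w w)) (subst (λ e → ι (2 ℕ.^ e) ℚ.< r) (sym suc-k≡) 2^e<r) , fromℕ-L r<n)
  where
  instance
    _ = ℕ.>-nonZero 0<w
    _ = ℕ.m*n≢0 w w
    _ = ℕ.m*n≢0 2 (w ℕ.* w)

  suc-k≡ : suc (ℕ.pred (2 ℕ.* (w ℕ.* w))) ≡ 2 ℕ.* (w ℕ.* w)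
  suc-k≡ = ℕ.suc-pred (2 ℕ.* (w ℕ.* w))

-- The term k = 0 in `exp` gives 1 + q ≤ exp q, here at q = (n + 1)². So crude a bound will do to
-- complete a bracket for the product.
√ln-U : ∀ n → U (√ (ln (fromℕ n))) (ι (suc n))
√ln-U n = 0<v , v , subst (ℚ._< v) (ι-def n) (ι-mono-< (ℕ.n<1+n n)) , 0 ,
  subst (0ℚ ℚ.<_) (sym t≡) (ℚ.<-trans 0<v big) ,
  subst (v ℚ.<_) (sym (trans (ℚ.*-identityʳ _) t≡)) big
  where
  v = ι (suc n)

  0<v : 0ℚ ℚ.< v
  0<v = ι-pos (s≤s z≤n)

  t≡ : 1ℚ ℚ.+ v ℚ.* v ℚ.* 1ℚ ≡ 1ℚ ℚ.+ ι (suc n ℕ.* suc n)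
  t≡ = cong (1ℚ ℚ.+_) (trans (ℚ.*-identityʳ (v ℚ.* v)) (sym (ι-* (suc n) (suc n))))

  big : v ℚ.< 1ℚ ℚ.+ ι (suc n ℕ.* suc n)
  big = ℚ.≤-<-trans (ι-mono-≤ (ℕ.m≤m*n (suc n) (suc n)))
    (subst (ℚ._< 1ℚ ℚ.+ ι (suc n ℕ.* suc n)) (ℚ.+-identityˡ _) (ℚ.+-monoˡ-< (ι (suc n ℕ.* suc n)) (ℚ.positive⁻¹ 1ℚ)))

^-L : ∀ n (y : Cut) {q} i j k → L y ((+ i ℤ.- + j) ℚ./ suc k) →
  q ^ℚ suc k ℚ.* ι (n ℕ.^ j) ℚ.< ι (n ℕ.^ i) → L (n ^ y) q
^-L n y {q} i j k Ly lt = inj₂ (i , j , k , Ly ,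
  subst₂ (λ a b → q ^ℚ suc k ℚ.* a ℚ.< b) (ι-def (n ℕ.^ j)) (ι-def (n ℕ.^ i)) lt)

-- A positive q < m ≤ M has q ^ D < n ^ a, which places it below n ^ (a / D) with a / D in the lower
-- cut of the exponent.
fromℕ≤^ : ∀ {n M a d} (y : Cut) → M ℕ.^ suc d ℕ.≤ n ℕ.^ a → L y (+ a ℚ./ suc d) →
  ∀ {m} → m ℕ.≤ M → fromℕ m ≤ n ^ y
fromℕ≤^ {n} {M} {a} {d} y M^D≤n^a Ly {m} m≤M {q} q<m with q ℚ.≤? 0ℚ
... | yes q≤0 = inj₁ q≤0
... | no  q≰0 = ^-L n y a 0 d (subst (λ i → L y (i ℚ./ suc d)) (sym (ℤ.+-identityʳ (+ a))) Ly) (begin-strict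
  q ^ℚ suc d ℚ.* ι 1 ≡⟨ cong (q ^ℚ suc d ℚ.*_) (ι-def 1) ⟩
  q ^ℚ suc d ℚ.* 1ℚ  ≡⟨ ℚ.*-identityʳ _ ⟩
  q ^ℚ suc d         <⟨ ^ℚ-monoˡ-< (ℚ.≰⇒> q≰0) (subst (q ℚ.<_) (sym (ι-def m)) q<m) d ⟩
  ι m ^ℚ suc d       ≡⟨ ι-^ m (suc d) ⟨
  ι (m ℕ.^ suc d)    ≤⟨ ι-mono-≤ (ℕ.≤-trans (ℕ.^-monoˡ-≤ (suc d) m≤M) M^D≤n^a) ⟩
  ι (n ℕ.^ a)        ∎)
  where open ℚ.≤-Reasoning

-- The real threshold against its integer form.

module _ {s : Cut} (s-cut : IsDedekind s) where

  open IsDedekind s-cut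

  -- Locatedness does not compare s with one rational. It only offers (a + 1) / D below s or (a + 2)
  -- / D above s, hence the width 2 / D of the enclosure.
  scan : ∀ d t a → L s (+ a ℚ./ suc d) → U s (+ suc (t ℕ.+ a) ℚ./ suc d) →
    ∃[ b ] a ℕ.≤ b × b ℕ.≤ t ℕ.+ a × L s (+ b ℚ./ suc d) × U s (+ suc (suc b) ℚ./ suc d)
  scan d zero    a La Ua = a , ℕ.≤-refl , ℕ.≤-refl , La , U-upper (/-mono-< d (ℕ.n<1+n (suc a))) Ua
  scan d (suc t) a La Ua with located (/-mono-< d (ℕ.n<1+n (suc a)))
  ... | inj₂ Ua+2 = a , ℕ.≤-refl , ℕ.m≤n+m a (suc t) , La , Ua+2
  ... | inj₁ La+1 with scan d t (suc a) La+1 (subst (λ z → U s (+ suc z ℚ./ suc d)) (sym (ℕ.+-suc t a)) Ua)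
  ...   | b , a<b , b≤ , Lb , Ub = b , ℕ.<⇒≤ a<b , ℕ.≤-trans b≤ (ℕ.≤-reflexive (ℕ.+-suc t a)) , Lb , Ub

  module _ (2<s : fromℕ 2 < s) (s<3 : s < fromℕ 3) where

    E : Cut
    E = (fromℕ 3 - s) * fromℚ ½

    L-2 : L s (2ℚ)
    L-2 = let q , 2<q , Lq = 2<s in L-lower 2<q Lq

    U-3 : U s (3ℚ)
    U-3 = let q , Uq , q<3 = s<3 in U-upper q<3 Uq

    3-s-L : ∀ {b p} → U s b → p ℚ.+ b ℚ.< 3ℚ → L (fromℕ 3 - s) p
    3-s-L {b} {p} Ub p+b<3 = let a , p+b<a , a<3 = ℚ.<-dense p+b<3 in
      a , b , a<3 , Ub , subst (ℚ._< a ℚ.- b) (solveℚ 2 (λ p b → p ⊕ b ⊖ b ⩦ p) refl p b) (ℚ.+-monoˡ-< (ℚ.- b) p+b<a)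

    3-s-U : ∀ {z} → 3ℚ ℚ.≤ z → U (fromℕ 3 - s) z
    3-s-U 3≤z = 4ℚ , 2ℚ , from-yes (3ℚ ℚ.<? 4ℚ) , L-2 , ℚ.<-≤-trans (from-yes (4ℚ ℚ.- 2ℚ ℚ.<? 3ℚ)) 3≤z

    -- The exponent is approached from below by (p , ½) with p > 0 even if
    -- the bound (3 - r) / 2 is not positive.
    E-L : ∀ {r q} → U s r → q ℚ.≤ (3ℚ ℚ.- r) ℚ.* ½ → L E q
    E-L {r} {q} Ur q≤ = E-L′
      where
      -- Both b₀ < 3 and r′ < r lie above s. Their minimum b makes 3 - b positive and also greater
      -- than 3 - r.
      b₀ = proj₁ s<3
      r′ = proj₁ (U-open Ur)
      b  = r′ ℚ.⊓ b₀

      Ub : U s b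
      Ub with ℚ.⊓-sel r′ b₀
      ... | inj₁ eq = subst (U s) (sym eq) (proj₂ (proj₂ (U-open Ur)))
      ... | inj₂ eq = subst (U s) (sym eq) (proj₁ (proj₂ s<3))

      b<r : b ℚ.< r
      b<r = ℚ.≤-<-trans (ℚ.p⊓q≤p r′ b₀) (proj₁ (proj₂ (U-open Ur)))

      b<3 : b ℚ.< 3ℚ
      b<3 = ℚ.≤-<-trans (ℚ.p⊓q≤q r′ b₀) (proj₂ (proj₂ s<3))

      max< : 0ℚ ℚ.⊔ (3ℚ ℚ.- r) ℚ.< 3ℚ ℚ.- b
      max< with ℚ.⊔-sel 0ℚ (3ℚ ℚ.- r)
      ... | inj₁ eq = subst₂ ℚ._<_ (trans (ℚ.+-inverseʳ b) (sym eq)) refl (ℚ.+-monoˡ-< (ℚ.- b) b<3)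
      ... | inj₂ eq = subst (ℚ._< 3ℚ ℚ.- b) (sym eq) (ℚ.+-monoʳ-< (3ℚ) (ℚ.neg-antimono-< b<r))

      E-L′ : L E q
      E-L′ with ℚ.<-dense max<
      ... | p , max<p , p<3-b = *-L {fromℕ 3 - s} {fromℚ ½} {p} {3ℚ ℚ.⊔ p} {c} {1ℚ}
          (3-s-L Ub (subst (p ℚ.+ b ℚ.<_) (solveℚ 2 (λ x b → x ⊖ b ⊕ b ⩦ x) refl (3ℚ) b) (ℚ.+-monoˡ-< b p<3-b)))
          (3-s-U (ℚ.p≤p⊔q (3ℚ) p)) c<½ (from-yes (½ ℚ.<? 1ℚ))
          (ℚ.<⇒≤ 0<p) (ℚ.p≤q⊔p (3ℚ) p) 0≤c (ℚ.<⇒≤ (ℚ.<-trans c<½ (from-yes (½ ℚ.<? 1ℚ))))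
          (subst (q ℚ.<_) (sym p*c≡m) (ℚ.≤-<-trans (ℚ.p≤q⊔p 0ℚ q) max<m))
        where
        0<p : 0ℚ ℚ.< p
        0<p = ℚ.≤-<-trans (ℚ.p≤p⊔q 0ℚ (3ℚ ℚ.- r)) max<p

        instance
          p-pos : ℚ.Positive p
          p-pos = ℚ.positive 0<p
          p≢0 : ℚ.NonZero p
          p≢0 = ℚ.pos⇒nonZero p

        q<p½ : q ℚ.< p ℚ.* ½
        q<p½ = ℚ.≤-<-trans q≤ (*-monoˡ-< 0<½ (ℚ.≤-<-trans (ℚ.p≤q⊔p 0ℚ (3ℚ ℚ.- r)) max<p))

        0⊔q<p½ : 0ℚ ℚ.⊔ q ℚ.< p ℚ.* ½
        0⊔q<p½ with ℚ.⊔-sel 0ℚ q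
        ... | inj₁ eq = subst (ℚ._< p ℚ.* ½) (sym eq) (*-pos 0<p 0<½)
        ... | inj₂ eq = subst (ℚ._< p ℚ.* ½) (sym eq) q<p½

        -- The lower endpoint c for ½ is chosen to give p c = m, strictly between the maximum of 0
        -- and q and p / 2.
        m     = proj₁ (ℚ.<-dense 0⊔q<p½)
        max<m = proj₁ (proj₂ (ℚ.<-dense 0⊔q<p½))
        m<p½  = proj₂ (proj₂ (ℚ.<-dense 0⊔q<p½))
        c     = m ℚ.* ℚ.1/ p

        p*c≡m : p ℚ.* c ≡ m
        p*c≡m = trans (solveℚ 3 (λ p m i → p ⊗ (m ⊗ i) ⩦ m ⊗ (p ⊗ i)) refl p m (ℚ.1/ p))
          (trans (cong (m ℚ.*_) (ℚ.*-inverseʳ p)) (ℚ.*-identityʳ m))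

        c<½ : c ℚ.< ½
        c<½ = ℚ.*-cancelˡ-<-nonNeg p {{ℚ.pos⇒nonNeg p}} (subst (ℚ._< p ℚ.* ½) (sym p*c≡m) m<p½)

        0≤c : 0ℚ ℚ.≤ c
        0≤c = ℚ.*-cancelˡ-≤-pos p (subst₂ ℚ._≤_ (sym (ℚ.*-zeroʳ p)) (sym p*c≡m)
          (ℚ.≤-trans (ℚ.p≤p⊔q 0ℚ q) (ℚ.<⇒≤ max<m)))

    -- Crude, from 3 - s < 3 and ½ < 1; it serves only as the upper end of a bracket.
    E-U : U E (4ℚ)
    E-U = *-U {fromℕ 3 - s} {fromℚ ½} {0ℚ} {3ℚ} {0ℚ} {1ℚ}
      (3-s-L (proj₁ (proj₂ s<3)) (subst (ℚ._< 3ℚ) (sym (ℚ.+-identityˡ _)) (proj₂ (proj₂ s<3))))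
      (3-s-U ℚ.≤-refl) 0<½ (from-yes (½ ℚ.<? 1ℚ))
      ℚ.≤-refl (from-yes (0ℚ ℚ.≤? 3ℚ)) ℚ.≤-refl (from-yes (0ℚ ℚ.≤? 1ℚ))
      (from-yes (3ℚ ℚ.* 1ℚ ℚ.<? 4ℚ))

    n^E-U : ∀ n {q} → ι (n ℕ.^ 4) ℚ.< q → U (n ^ E) q
    n^E-U n {q} lt = ℚ.≤-<-trans 0≤ι lt , 4 , 0 , 0 , E-U ,
      subst₂ ℚ._<_ (ι-def (n ℕ.^ 4)) (sym (trans (ℚ.*-identityʳ (q ^ℚ 1)) (ℚ.*-identityʳ q))) lt

    -- Otherwise the rational (κ + 1) / 2 w lies below n ^ E, and 2 w lies
    -- below 3 √ (ln n).
    threshold⇒¬small : ∀ {n w M a d κ} → 0 ℕ.< w → w ℕ.≤ n → 2 ℕ.^ (2 ℕ.* (w ℕ.* w)) ℕ.< n →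
      n ℕ.^ a ℕ.< suc M ℕ.^ suc d → 4 ℕ.^ suc d ℕ.* n ℕ.^ 2 ℕ.≤ 5 ℕ.^ suc d →
      U s (+ suc (suc a) ℚ./ suc d) →
      fromℕ 3 * √ (ln (fromℕ n)) * n ^ E ≤ fromℕ κ →
      ¬ TooSmall n w M κ
    threshold⇒¬small {n} {w} {M} {a} {d} {κ} 0<w w≤n lo n^a<M^D 4^Dn²≤5^D Ur le small =
      ℚ.<-irrefl (ι-def κ) (le below)
      where
      D = suc d
      k = ℕ.pred (2 ℕ.* D)
      W = ι (2 ℕ.* w)

      0<W : 0ℚ ℚ.< W
      0<W = ι-pos (ℕ.≤-trans 0<w (ℕ.m≤m+n w _))

      instance
        W-pos : ℚ.Positive W
        W-pos = ℚ.positive 0<W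
        W≢0 : ℚ.NonZero W
        W≢0 = ℚ.pos⇒nonZero W

      c = ι (suc κ) ℚ.* ℚ.1/ W

      cW≡ : c ℚ.* W ≡ ι (suc κ)
      cW≡ = trans (ℚ.*-assoc (ι (suc κ)) (ℚ.1/ W) W)
        (trans (cong (ι (suc κ) ℚ.*_) (ℚ.*-inverseˡ W)) (ℚ.*-identityʳ _))

      0<c : 0ℚ ℚ.< c
      0<c = *-pos (ι-pos (s≤s z≤n)) (ℚ.positive⁻¹ (ℚ.1/ W) {{ℚ.1/pos⇒pos W}})

      c≤κ+1 : c ℚ.≤ ι (suc κ)
      c≤κ+1 = subst₂ ℚ._≤_ (ℚ.*-identityʳ c) cW≡
        (ℚ.*-monoˡ-≤-nonNeg c {{ℚ.nonNegative (ℚ.<⇒≤ 0<c)}} (subst (ℚ._≤ W) (ι-def 1) (ι-mono-≤ (ℕ.≤-trans 0<w (ℕ.m≤m+n w _)))))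

      c-power : c ^ℚ suc k ℚ.* ι (n ℕ.^ suc (suc a)) ℚ.< ι (n ℕ.^ (3 ℕ.* D))
      c-power = ℚ.*-cancelʳ-<-nonNeg (W ^ℚ suc k) {{ℚ.nonNegative (ℚ.<⇒≤ (^ℚ-pos 0<W (suc k)))}} (begin-strict
        c ^ℚ suc k ℚ.* N₁ ℚ.* W ^ℚ suc k
          ≡⟨ solveℚ 3 (λ x y z → x ⊗ y ⊗ z ⩦ x ⊗ z ⊗ y) refl (c ^ℚ suc k) N₁ (W ^ℚ suc k) ⟩
        c ^ℚ suc k ℚ.* W ^ℚ suc k ℚ.* N₁
          ≡⟨ cong (ℚ._* N₁) (^ℚ-distrib-* c W (suc k)) ⟨
        (c ℚ.* W) ^ℚ suc k ℚ.* N₁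
          ≡⟨ cong (λ z → z ^ℚ suc k ℚ.* N₁) cW≡ ⟩
        ι (suc κ) ^ℚ suc k ℚ.* N₁
          ≡⟨ cong (ℚ._* N₁) (ι-^ (suc κ) (suc k)) ⟨
        ι (suc κ ℕ.^ suc k) ℚ.* N₁
          ≡⟨ ι-* (suc κ ℕ.^ suc k) (n ℕ.^ suc (suc a)) ⟨
        ι (suc κ ℕ.^ suc k ℕ.* n ℕ.^ suc (suc a))
          <⟨ ι-mono-< (power-bound (suc κ) n w (suc M) a D n^a<M^D 4^Dn²≤5^D small) ⟩
        ι (n ℕ.^ (3 ℕ.* D) ℕ.* (2 ℕ.* w) ℕ.^ suc k)
          ≡⟨ ι-* (n ℕ.^ (3 ℕ.* D)) ((2 ℕ.* w) ℕ.^ suc k) ⟩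
        ι (n ℕ.^ (3 ℕ.* D)) ℚ.* ι ((2 ℕ.* w) ℕ.^ suc k)
          ≡⟨ cong (ι (n ℕ.^ (3 ℕ.* D)) ℚ.*_) (ι-^ (2 ℕ.* w) (suc k)) ⟩
        ι (n ℕ.^ (3 ℕ.* D)) ℚ.* W ^ℚ suc k ∎)
        where
        open ℚ.≤-Reasoning
        N₁ = ι (n ℕ.^ suc (suc a))

      n^E-L : L (n ^ E) c
      n^E-L = ^-L n E {c} (3 ℕ.* D) (suc (suc a)) k (E-L Ur (exponent-bound (suc (suc a)) d k refl)) c-power

      w≤1+n : ι w ℚ.≤ ι (suc n)
      w≤1+n = ι-mono-≤ (ℕ.m≤n⇒m≤1+n w≤n)

      -- A lower endpoint for the cut of 3 must lie strictly below 3; with 5 / 2 the product still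
      -- exceeds 2 w.
      2w< : W ℚ.< 5/2 ℚ.* ι w
      2w< = subst (ℚ._< 5/2 ℚ.* ι w) (sym (ι-2* w))
        (*-monoˡ-< (ι-pos 0<w) (from-yes (2ℚ ℚ.<? 5/2)))

      5/2<3 : 5/2 ℚ.< 3ℚ
      5/2<3 = from-yes (5/2 ℚ.<? 3ℚ)

      3<4 : 3ℚ ℚ.< 4ℚ
      3<4 = from-yes (3ℚ ℚ.<? 4ℚ)

      factor-L : L (fromℕ 3 * √ (ln (fromℕ n))) W
      factor-L = *-L {fromℕ 3} {√ (ln (fromℕ n))} 5/2<3 3<4 (√ln-L w 0<w lo) (√ln-U n)
        (from-yes (0ℚ ℚ.≤? 5/2)) (from-yes (5/2 ℚ.≤? 4ℚ)) 0≤ι w≤1+n 2w<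

      factor-U : U (fromℕ 3 * √ (ln (fromℕ n))) (ι (suc (4 ℕ.* suc n)))
      factor-U = *-U {fromℕ 3} {√ (ln (fromℕ n))} 5/2<3 3<4 (√ln-L w 0<w lo) (√ln-U n)
        (from-yes (0ℚ ℚ.≤? 5/2)) (from-yes (5/2 ℚ.≤? 4ℚ)) 0≤ι w≤1+n
        (subst (ℚ._< ι (suc (4 ℕ.* suc n))) (trans (ι-* 4 (suc n)) (cong (ℚ._* ι (suc n)) (ι-def 4))) (ι-mono-< {4 ℕ.* suc n} (ℕ.n<1+n (4 ℕ.* suc n))))

      W≤ : W ℚ.≤ ι (suc (4 ℕ.* suc n))
      W≤ = ι-mono-≤ (ℕ.m≤n⇒m≤1+n (ℕ.*-mono-≤ {2} {4} (s≤s (s≤s z≤n)) (ℕ.m≤n⇒m≤1+n w≤n)))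

      -- The summand κ + 1 lifts the upper endpoint for n ^ E above the lower endpoint c as well, as
      -- `*-L` demands.
      n⁴<n⁴+κ+1 : n ℕ.^ 4 ℕ.< n ℕ.^ 4 ℕ.+ suc κ
      n⁴<n⁴+κ+1 = ℕ.m<m+n (n ℕ.^ 4) (s≤s z≤n)

      -- The lower endpoints multiply to κ + 1, so κ is strictly below the product, which the
      -- assumed bound by κ forbids. This is why `TooSmall` involves κ + 1.
      below : L (fromℕ 3 * √ (ln (fromℕ n)) * n ^ E) (ι κ)
      below = *-L {fromℕ 3 * √ (ln (fromℕ n))} {n ^ E} factor-L factor-U n^E-L
        (n^E-U n (ι-mono-< n⁴<n⁴+κ+1)) (ℚ.<⇒≤ 0<W) W≤ (ℚ.<⇒≤ 0<c)
        (ℚ.≤-trans c≤κ+1 (ι-mono-≤ (ℕ.m≤n+m (suc κ) (n ℕ.^ 4))))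
        (subst (ι κ ℚ.<_) (trans (sym cW≡) (ℚ.*-comm c W)) (ι-mono-< (ℕ.n<1+n κ)))

-- Integer approximations of ln n and n ^ s, and the conclusion.

/-cancel : ∀ c d → + (c ℕ.* suc d) ℚ./ suc d ≡ + c ℚ./ 1
/-cancel c d = ℚ.fromℚᵘ-cong {mkℚᵘ (+ (c ℕ.* suc d)) d} {mkℚᵘ (+ c) 0}
  (*≡* (trans (ℤ.*-identityʳ (+ (c ℕ.* suc d))) (ℤ.pos-* c (suc d))))

-- That is, n ^ (2 / D) ≤ 5 / 4 for D = 8 n.
4^8n*n²≤5^8n : ∀ n → 4 ℕ.^ (8 ℕ.* n) ℕ.* n ℕ.^ 2 ℕ.≤ 5 ℕ.^ (8 ℕ.* n)
4^8n*n²≤5^8n n = begin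
  4 ℕ.^ (8 ℕ.* n) ℕ.* n ℕ.^ 2       ≡⟨ cong₂ ℕ._*_ (sym (ℕ.^-*-assoc 4 8 n)) (cong (n ℕ.*_) (ℕ.*-identityʳ n)) ⟩
  (4 ℕ.^ 8) ℕ.^ n ℕ.* (n ℕ.* n)     ≤⟨ ℕ.*-monoʳ-≤ ((4 ℕ.^ 8) ℕ.^ n) (n²≤4^n n) ⟩
  (4 ℕ.^ 8) ℕ.^ n ℕ.* 4 ℕ.^ n       ≡⟨ ^-distribʳ-* n (4 ℕ.^ 8) 4 ⟨
  -- The origin of D = 8 n: eight factors 5 / 4 exceed 4, so n times as many absorb 4 ^ n and with
  -- it n².
  (4 ℕ.^ 8 ℕ.* 4) ℕ.^ n             ≤⟨ ℕ.^-monoˡ-≤ n (from-yes (4 ℕ.^ 8 ℕ.* 4 ℕ.≤? 5 ℕ.^ 8)) ⟩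
  (5 ℕ.^ 8) ℕ.^ n                   ≡⟨ ℕ.^-*-assoc 5 8 n ⟩
  5 ℕ.^ (8 ℕ.* n)                   ∎
  where open ℕ.≤-Reasoning

-- It ends the search for w, whose condition fails at n + 26, and also yields w ≤ n.
n<2^[2n²] : ∀ n → n ℕ.< 2 ℕ.^ (2 ℕ.* (n ℕ.* n))
n<2^[2n²] zero      = s≤s z≤n
n<2^[2n²] n@(suc _) = ℕ.<-≤-trans (n<2^n n)
  (ℕ.^-monoʳ-≤ 2 (ℕ.≤-trans (ℕ.m≤m*n n n) (ℕ.m≤n*m (n ℕ.* n) 2)))

sqrt-log : ∀ n → 2 ℕ.^ (2 ℕ.* (26 ℕ.* 26)) ℕ.< n →
  ∃[ w ] 26 ℕ.≤ w × w ℕ.≤ n × 2 ℕ.^ (2 ℕ.* (w ℕ.* w)) ℕ.< n × n ℕ.≤ 2 ℕ.^ (2 ℕ.* (suc w ℕ.* suc w))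
sqrt-log n large =
  let w , 26≤w , _ , lo , hi = crossing {λ w → 2 ℕ.^ (2 ℕ.* (w ℕ.* w)) ℕ.< n} (λ w → 2 ℕ.^ (2 ℕ.* (w ℕ.* w)) ℕ.<? n) 26 n large
        (ℕ.<-asym (ℕ.≤-<-trans (ℕ.m≤m+n n 26) (n<2^[2n²] (n ℕ.+ 26))))
  in w , 26≤w , ℕ.<⇒≤ (ℕ.<-trans (n<2^[2n²] w) lo) , lo , ℕ.≮⇒≥ hi

-- M is the integer part of n ^ (a / D). The exponent lies between 2 and 3, which bounds both M and
-- the search for it.
root : ∀ n a d .{{_ : NonZero n}} → 2 ℕ.* suc d ℕ.≤ a → a ℕ.≤ 3 ℕ.* suc d →
  ∃[ M ] n ℕ.^ 2 ℕ.≤ M × M ℕ.≤ n ℕ.^ 3 × M ℕ.^ suc d ℕ.≤ n ℕ.^ a × n ℕ.^ a ℕ.< suc M ℕ.^ suc d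
root n a d 2D≤a a≤3D =
  let M , lo , _ , M^D≤n^a , n^a<M′^D = crossing {λ M → M ℕ.^ suc d ℕ.≤ n ℕ.^ a} (λ M → M ℕ.^ suc d ℕ.≤? n ℕ.^ a) (n ℕ.^ 2) (suc (n ℕ.^ 3))
        (ℕ.≤-trans (ℕ.≤-reflexive (ℕ.^-*-assoc n 2 (suc d))) (ℕ.^-monoʳ-≤ n 2D≤a))
        (λ le → ℕ.<⇒≱ (s≤s (ℕ.m≤m+n (n ℕ.^ 3) (n ℕ.^ 2))) (≤n³ _ le))
  in M , lo , ≤n³ M M^D≤n^a , M^D≤n^a , ℕ.≰⇒> n^a<M′^D
  where
  ≤n³ : ∀ M → M ℕ.^ suc d ℕ.≤ n ℕ.^ a → M ℕ.≤ n ℕ.^ 3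
  ≤n³ M le = ℕ.≮⇒≥ (λ n³<M → ℕ.<⇒≱ (ℕ.^-monoˡ-< (suc d) n³<M)
    (ℕ.≤-trans le (ℕ.≤-trans (ℕ.^-monoʳ-≤ n a≤3D) (ℕ.≤-reflexive (sym (ℕ.^-*-assoc n 3 (suc d)))))))

module _ {s : Cut} (s-cut : IsDedekind s) (2<s : fromℕ 2 < s) (s<3 : s < fromℕ 3) where

  Witness : ℕ → Set
  Witness n = ∃[ f ] HasDegree {n} f 3 ×
    fromℕ (thickness f) ≤ n ^ s ×
    (∀ (K : Subset n) → Nonempty K →
      fromℕ 3 * √ (ln (fromℕ n)) * n ^ ((fromℕ 3 - s) * fromℚ ½) ≤ fromℕ ∣ K ∣ →
      HasDegree (restrict f K) 3)

  module _ (n d : ℕ) .{{_ : NonZero n}} (4^Dn²≤5^D : 4 ℕ.^ suc d ℕ.* n ℕ.^ 2 ℕ.≤ 5 ℕ.^ suc d) where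

    module _ {a w M : ℕ} (La : L s (+ a ℚ./ suc d)) (Ua+2 : U s (+ suc (suc a) ℚ./ suc d))
      (M^D≤n^a : M ℕ.^ suc d ℕ.≤ n ℕ.^ a) (n^a<M′^D : n ℕ.^ a ℕ.< suc M ℕ.^ suc d)
      (26≤w : 26 ℕ.≤ w) (w≤n : w ℕ.≤ n) (lo : 2 ℕ.^ (2 ℕ.* (w ℕ.* w)) ℕ.< n)
      (hi : n ℕ.≤ 2 ℕ.^ (2 ℕ.* (suc w ℕ.* suc w))) (n²≤M : n ℕ.^ 2 ℕ.≤ M) (M≤n³ : M ℕ.≤ n ℕ.^ 3) where

      wide⇒ : ∀ {κ} → fromℕ 3 * √ (ln (fromℕ n)) * n ^ ((fromℕ 3 - s) * fromℚ ½) ≤ fromℕ κ →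
        ¬ TooSmall n w M κ
      wide⇒ {κ} = threshold⇒¬small s-cut 2<s s<3 {n} {w} {M} {a} {d} {κ}
        (ℕ.≤-trans (s≤s z≤n) 26≤w) w≤n lo n^a<M′^D 4^Dn²≤5^D Ua+2

      choose-f : ∀ {k m} → m ℕ.≤ M → (∀ κ → ¬ TooSmall n w M κ → k ℕ.≤ κ) →
        (∃[ f ] HasDegree {n} f 3 × thickness f ℕ.≤ m × (∀ K → k ℕ.≤ ∣ K ∣ → HasDegree (restrict f K) 3)) → Witness n
      choose-f m≤M minimal (f , degree , thin , restrictions) =
        f , degree , fromℕ≤^ {n} {M} {a} {d} s M^D≤n^a La (ℕ.≤-trans thin m≤M) ,
        λ K _ wide → restrictions K (minimal ∣ K ∣ (wide⇒ {∣ K ∣} wide))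

      choose-k : Parameters n w M → Witness n
      choose-k (k , m , 0<C , k≤n , m≤M , few , minimal) =
        choose-f m≤M minimal (sparse-homogeneous {n} {3} {k} {m} 0<C k≤n few)

    witness : 2 ℕ.^ (2 ℕ.* (26 ℕ.* 26)) ℕ.< n → Witness n
    witness large = from-scan (sqrt-log n large) (scan s-cut d d (2 ℕ.* suc d)
        (subst (L s) (sym (/-cancel 2 d)) (L-2 s-cut 2<s s<3))
        (subst (U s) (sym (/-cancel 3 d)) (U-3 s-cut 2<s s<3)))
      where
      from-root : ∀ {a w} → L s (+ a ℚ./ suc d) → U s (+ suc (suc a) ℚ./ suc d) →
        26 ℕ.≤ w → w ℕ.≤ n → 2 ℕ.^ (2 ℕ.* (w ℕ.* w)) ℕ.< n → n ℕ.≤ 2 ℕ.^ (2 ℕ.* (suc w ℕ.* suc w)) →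
        (∃[ M ] n ℕ.^ 2 ℕ.≤ M × M ℕ.≤ n ℕ.^ 3 × M ℕ.^ suc d ℕ.≤ n ℕ.^ a × n ℕ.^ a ℕ.< suc M ℕ.^ suc d) → Witness n
      from-root {a} {w} La Ua+2 26≤w w≤n lo hi (M , n²≤M , M≤n³ , M^D≤n^a , n^a<M′^D) =
        choose-k {a} {w} {M} La Ua+2 M^D≤n^a n^a<M′^D 26≤w w≤n lo hi n²≤M M≤n³
          (parameters n w M 26≤w lo hi n²≤M M≤n³)

      from-scan :
        (∃[ w ] 26 ℕ.≤ w × w ℕ.≤ n × 2 ℕ.^ (2 ℕ.* (w ℕ.* w)) ℕ.< n × n ℕ.≤ 2 ℕ.^ (2 ℕ.* (suc w ℕ.* suc w))) →
        (∃[ a ] 2 ℕ.* suc d ℕ.≤ a × a ℕ.≤ d ℕ.+ 2 ℕ.* suc d × L s (+ a ℚ./ suc d) × U s (+ suc (suc a) ℚ./ suc d)) →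
        Witness n
      from-scan (w , 26≤w , w≤n , lo , hi) (a , 2D≤a , a<3D , La , Ua+2) =
        from-root {a} {w} La Ua+2 26≤w w≤n lo hi (root n a d 2D≤a (ℕ.m≤n⇒m≤1+n a<3D))

theorem7 : (s : Cut) → IsDedekind s → fromℕ 2 < s → s < fromℕ 3 →
    ∃[ N ] ∀ (n : ℕ) → N ℕ.≤ n →
    ∃[ f ] HasDegree {n} f 3 ×
      fromℕ (thickness f) ≤ n ^ s ×
      (∀ (K : Subset n) → Nonempty K →
        fromℕ 3 * √ (ln (fromℕ n)) * n ^ ((fromℕ 3 - s) * fromℚ ½) ≤ fromℕ ∣ K ∣ →
        HasDegree (restrict f K) 3)
-- Exceeding 4 ^ (26²) is what makes w at least 26.
theorem7 s s-cut 2<s s<3 = suc (2 ℕ.^ (2 ℕ.* (26 ℕ.* 26))) , λ n large →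
  witness s-cut 2<s s<3 n (ℕ.pred (8 ℕ.* n)) {{nonZero large}}
    (subst (λ D → 4 ℕ.^ D ℕ.* n ℕ.^ 2 ℕ.≤ 5 ℕ.^ D)
      (sym (ℕ.suc-pred (8 ℕ.* n) {{ℕ.m*n≢0 8 n {{_}} {{nonZero large}}}})) (4^8n*n²≤5^8n n)) large
  where
  nonZero : ∀ {m n} → m ℕ.< n → NonZero n
  nonZero m<n = ℕ.>-nonZero (ℕ.≤-<-trans z≤n m<n)
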